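{- Let $G$ be an indecomposable graph with $v(G)\geq 6$, and let $a\neq b\in V(G)$. If $\mathbb{I}(G)$ is $\{a,b\}$-covered, then $G$ contains an $\{a,b\}$-minimal induced subgraph of cardinality $v(G)$, $v(G)-1$, $v(G)-3$ or $v(G)-5$; that is, there is $X\subseteq V(G)$ with $a,b\in X$ and $|X|\in\{v(G),v(G)-1,v(G)-3,v(G)-5\}$ such that $G[X]$ is $\{a,b\}$-minimal.
   Context: Graphs are finite, simple and undirected; $v(G)=|V(G)|$, and $G[X]$ is the subgraph induced by $X\subseteq V(G)$. A subset $I\subseteq V(G)$ is an interval of $G$ if every vertex outside $I$ is adjacent to all or to none of the vertices of $I$. The sets $\emptyset$, $V(G)$ and $\{x\}$ ($x\in V(G)$) are the trivial intervals. $G$ is indecomposable if all its intervals are trivial, and decomposable otherwise. For an indecomposable graph $G=(V,E)$, the indecomposability graph $\mathbb{I}(G)$ has vertex set $V$, and its edges are the pairs $\{x,y\}$ of distinct vertices such that $G[V\setminus\{x,y\}]$ is indecomposable. A graph $H$ is $X$-covered, for $X\subseteq V(H)$, if $X$ is a vertex cover of $H$, i.e. every edge of $H$ meets $X$. Given two distinct vertices $x,y$ of an indecomposable graph $G$ with $v(G)\ge 4$, $G$ is $\{x,y\}$-minimal if for every proper subset $X$ of $V(G)$ with $x,y\in X$ and $|X|\geq 3$, $G[X]$ is decomposable. -}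

module Defs where

open import Data.Nat using (ℕ; _≤_)
open import Data.Fin using (Fin)
open import Data.Fin.Properties using (_≟_; all?; any?)
open import Data.Fin.Subset
open import Data.Fin.Subset.Properties using (_∈?_; _⊆?_; anySubset?; ∪-comm)
open import Data.Bool.Properties using () renaming (_≟_ to _≟ᵇ_)
open import Data.Vec.Properties using (≡-dec)
open import Data.Product using (_×_; _,_; ∃)
open import Data.Sum using (_⊎_)
open import Relation.Binary.Definitions using (Decidable; Symmetric; Irreflexive)
open import Relation.Binary.PropositionalEquality using (_≡_; _≢_; sym; subst)
open import Relation.Nullary using (¬_; Dec; ¬?; _×-dec_; _⊎-dec_; _→-dec_)
open import Relation.Nullary.Decidable using (map′; decidable-stable)

-- The vertex set is an arbitrary subset of an ambient label set Fin n, so that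
-- an induced subgraph is again a graph on (some of) the same vertices.
record Graph (n : ℕ) : Set₁ where
  field
    V           : Subset n
    Adj         : Fin n → Fin n → Set
    adj?        : Decidable Adj
    adj-sym     : Symmetric Adj
    adj-irrefl  : Irreflexive _≡_ Adj
    adj-in-V    : ∀ {x y} → Adj x y → x ∈ V × y ∈ V

open Graph public

private variable n : ℕ

v : Graph n → ℕ
v G = ∣ V G ∣

-- Meaningful for X ⊆ V G; the inclusion is demanded wherever it is used.
infix 9 _[_]
_[_] : Graph n → Subset n → Graph n
G [ X ] = record
  { V          = X
  ; Adj        = λ x y → x ∈ X × y ∈ X × Adj G x y
  ; adj?       = λ x y → x ∈? X ×-dec y ∈? X ×-dec adj? G x y
  ; adj-sym    = λ (p , q , e) → q , p , adj-sym G e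
  ; adj-irrefl = λ x≡y (_ , _ , e) → adj-irrefl G x≡y e
  ; adj-in-V   = λ (p , q , _) → p , q
  }

Interval : Graph n → Subset n → Set
Interval G I = I ⊆ V G ×
  (∀ x → x ∈ V G → x ∉ I →
    (∀ y → y ∈ I → Adj G x y) ⊎ (∀ y → y ∈ I → ¬ Adj G x y))

Trivial : Graph n → Subset n → Set
Trivial G I = I ≡ ⊥ ⊎ I ≡ V G ⊎ ∃ λ x → x ∈ V G × I ≡ ⁅ x ⁆

Indecomposable : Graph n → Set
Indecomposable G = ∀ I → Interval G I → Trivial G I

Decomposable : Graph n → Set
Decomposable G = ¬ Indecomposable G

interval? : (G : Graph n) (I : Subset n) → Dec (Interval G I)
interval? G I = I ⊆? V G ×-dec
  all? λ x → x ∈? V G →-dec (¬? (x ∈? I) →-dec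
    (all? (λ y → y ∈? I →-dec adj? G x y)
      ⊎-dec all? (λ y → y ∈? I →-dec ¬? (adj? G x y))))

trivial? : (G : Graph n) (I : Subset n) → Dec (Trivial G I)
trivial? G I = I ≟ˢ ⊥ ⊎-dec I ≟ˢ V G ⊎-dec
  any? λ x → x ∈? V G ×-dec I ≟ˢ ⁅ x ⁆
  where _≟ˢ_ = ≡-dec _≟ᵇ_

indecomposable? : (G : Graph n) → Dec (Indecomposable G)
indecomposable? G =
  map′ (λ none I int → decidable-stable (trivial? G I) λ ¬t → none (I , int , ¬t))
       (λ ind (I , int , ¬t) → ¬t (ind I int))
       (¬? (anySubset? λ I → interval? G I ×-dec ¬? (trivial? G I)))

𝕀 : Graph n → Graph n
𝕀 G = record
  { V          = V G
  ; Adj        = λ x y → x ∈ V G × y ∈ V G × x ≢ y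
                   × Indecomposable (G [ V G ─ (⁅ x ⁆ ∪ ⁅ y ⁆) ])
  ; adj?       = λ x y → x ∈? V G ×-dec y ∈? V G ×-dec ¬? (x ≟ y)
                   ×-dec indecomposable? (G [ V G ─ (⁅ x ⁆ ∪ ⁅ y ⁆) ])
  ; adj-sym    = λ {x} {y} (p , q , x≢y , ind) →
                   q , p , (λ y≡x → x≢y (sym y≡x)) ,
                   subst (λ P → Indecomposable (G [ V G ─ P ])) (∪-comm ⁅ x ⁆ ⁅ y ⁆) ind
  ; adj-irrefl = λ x≡y (_ , _ , x≢y , _) → x≢y x≡y
  ; adj-in-V   = λ (p , q , _) → p , q
  }

Covered : Graph n → Subset n → Set
Covered H X = X ⊆ V H × (∀ x y → Adj H x y → x ∈ X ⊎ y ∈ X)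

-- The conditions under which {x,y}-minimality is defined (x, y distinct
-- vertices, G indecomposable, at least 4 vertices) are part of the predicate.
record Minimal (G : Graph n) (x y : Fin n) : Set where
  field
    x∈V            : x ∈ V G
    y∈V            : y ∈ V G
    x≢y            : x ≢ y
    indecomposable : Indecomposable G
    4≤v            : 4 ≤ v G
    minimal        : ∀ X → X ⊂ V G → x ∈ X → y ∈ X → 3 ≤ ∣ X ∣ →
                     Decomposable (G [ X ])

{-# OPTIONS --safe #-}
-- Adjoin an isolated vertex ∞ to G. A set I of vertices is an interval of G[X] exactly when the
-- bipartition of X ∪ {∞} into I and its complement is a "split": the adjacency matrix between the two
-- sides satisfies g a c + g b c + g a d + g b d = 0. This condition does not change when the two sides
-- are exchanged, so ∞ needs no special treatment, and G[X] is indecomposable iff X ∪ {∞} is "prime",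
-- i.e. has no split with two elements on either side.
--
-- Take X minimal with a, b ∈ X and G[X] indecomposable. The covering hypothesis says that no prime set
-- containing X has codimension 2, so by the Ehrenfeucht–Rozenberg theorem none has positive even
-- codimension. It remains to exclude odd codimensions ≥ 7, and, climbing by the same theorem,
-- codimension 7. As S ∪ {z} is never prime when S ⊇ X is prime of codimension 3, 5 or 7, every z has a
-- unique twin in S. Three disjoint pairs p₁, p₂, p₃ are found such that S together with any one or two
-- of them, or all three, is prime. Let w be the one remaining vertex and let t₁, t₂, t₃ be its twins in
-- S ∪ p₂ ∪ p₃, S ∪ p₁ ∪ p₃ and S ∪ p₁ ∪ p₂. Two equal ones would be a twin of w in the whole graph, which
-- is prime; so they are distinct, and this forces them to lie cyclically in the three pairs, which is
-- impossible.

module Submission where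

open import Defs
open import Data.Bool using (Bool; true; false; _xor_)
open import Data.Bool.Properties using (xor-same) renaming (_≟_ to _≟ᵇ_)
open import Data.Bool.Solver using (module xor-∧-Solver)
open import Data.Nat using (ℕ; zero; suc; _+_; _≤_; _<_; _∸_; s≤s; z≤n; s≤s⁻¹)
open import Data.Nat.Properties using (≤-trans; ≤-refl; ≤-reflexive; <-irrefl; +-suc; m≤n⇒m≤1+n; m≤n+m; _≤?_; m∸n+n≡m)
open import Data.Fin using (Fin; zero; suc)
open import Data.Fin.Properties using (_≟_; all?; any?; suc-injective)
open import Data.Fin.Subset using (Subset; inside; outside; _∈_; _∉_; _⊆_; _⊂_; ∣_∣; ⁅_⁆; _∪_; _─_; ∁)
open import Data.Fin.Subset.Properties
open import Data.Vec using (_∷_; here; there; tabulate)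
open import Data.Vec.Properties using (lookup⇒[]=; []=⇒lookup; lookup∘tabulate)
open import Data.Product using (∃; ∃₂; _×_; _,_; proj₁; proj₂)
open import Data.Sum using (_⊎_; inj₁; inj₂; [_,_]′)
import Data.Empty as Empty
open import Function using (_∘_; id; case_of_; mk⇔)
open import Relation.Unary using (Decidable)
open import Relation.Binary.PropositionalEquality using (_≡_; _≢_; refl; sym; trans; cong; cong₂; subst; ≢-sym)
open import Relation.Nullary using (¬_; Dec; yes; no; does; ¬?; _×-dec_; _⊎-dec_; _→-dec_; contradiction)
open import Relation.Nullary.Decidable using (map′; decidable-stable; dec-true; does-⇔)

-- Adding elements to finite subsets, and counting.

infixl 5 _⊕_
_⊕_ : ∀ {m} → Subset m → Fin m → Subset m
S ⊕ x = S ∪ ⁅ x ⁆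

module _ {m : ℕ} where

  ⊕⁺ : ∀ {S : Subset m} {x y} → y ∈ S → y ∈ S ⊕ x
  ⊕⁺ y∈S = x∈p∪q⁺ (inj₁ y∈S)

  ⊕-new : ∀ {S : Subset m} {x} → x ∈ S ⊕ x
  ⊕-new = x∈p∪q⁺ (inj₂ (x∈⁅x⁆ _))

  ⊕⁻ : ∀ {S : Subset m} {x y} → y ∈ S ⊕ x → y ∈ S ⊎ y ≡ x
  ⊕⁻ {S} y∈ with x∈p∪q⁻ S _ y∈
  ... | inj₁ p = inj₁ p
  ... | inj₂ p = inj₂ (x∈⁅y⁆⇒x≡y _ p)

  ⊕⊕⁻ : ∀ {S : Subset m} {x y z} → z ∈ S ⊕ x ⊕ y → z ∈ S ⊎ z ≡ x ⊎ z ≡ y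
  ⊕⊕⁻ z∈ with ⊕⁻ z∈
  ... | inj₂ q = inj₂ (inj₂ q)
  ... | inj₁ z∈′ with ⊕⁻ z∈′
  ...   | inj₁ p = inj₁ p
  ...   | inj₂ q = inj₂ (inj₁ q)

  ⊕⊕-mono : ∀ {S S′ : Subset m} {x y} → S ⊆ S′ → S ⊕ x ⊕ y ⊆ S′ ⊕ x ⊕ y
  ⊕⊕-mono S⊆S′ z∈ with ⊕⊕⁻ z∈
  ... | inj₁ p           = ⊕⁺ (⊕⁺ (S⊆S′ p))
  ... | inj₂ (inj₁ refl) = ⊕⁺ ⊕-new
  ... | inj₂ (inj₂ refl) = ⊕-new

  fromPred : {A : Fin m → Set} → Decidable A → Subset m
  fromPred A? = tabulate (does ∘ A?)

  module _ {A : Fin m → Set} (A? : Decidable A) where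

    ∈-fromPred⁺ : ∀ {x} → A x → x ∈ fromPred A?
    ∈-fromPred⁺ {x} a = lookup⇒[]= x _ (trans (lookup∘tabulate _ x) (dec-true (A? x) a))

    ∈-fromPred⁻ : ∀ {x} → x ∈ fromPred A? → A x
    ∈-fromPred⁻ {x} x∈ with A? x | trans (sym (lookup∘tabulate (does ∘ A?) x)) ([]=⇒lookup x∈)
    ... | yes a | _ = a
    ... | no _  | ()

∣⊕∣ : ∀ {m} {S : Subset m} {x} → x ∉ S → ∣ S ⊕ x ∣ ≡ suc ∣ S ∣
∣⊕∣ {S = inside  ∷ S} {zero}  x∉ = contradiction here x∉
∣⊕∣ {S = outside ∷ S} {zero}  x∉ = cong (suc ∘ ∣_∣) (∪-identityʳ S)
∣⊕∣ {S = inside  ∷ S} {suc x} x∉ = cong suc (∣⊕∣ (x∉ ∘ there))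
∣⊕∣ {S = outside ∷ S} {suc x} x∉ = ∣⊕∣ (x∉ ∘ there)

∣⊕∣≤ : ∀ {m} (S : Subset m) x → ∣ S ⊕ x ∣ ≤ suc ∣ S ∣
∣⊕∣≤ S x with x ∈? S
... | yes x∈ = m≤n⇒m≤1+n (p⊆q⇒∣p∣≤∣q∣ {p = S ⊕ x} {S} λ y∈ → [ id , (λ { refl → x∈ }) ]′ (⊕⁻ y∈))
... | no x∉  = ≤-reflexive (∣⊕∣ x∉)

∣⊕⊕∣ : ∀ {m} {S : Subset m} {x y} → x ∉ S → y ∉ S → x ≢ y → ∣ S ⊕ x ⊕ y ∣ ≡ 2 + ∣ S ∣
∣⊕⊕∣ x∉ y∉ x≢y = trans (∣⊕∣ ([ y∉ , ≢-sym x≢y ]′ ∘ ⊕⁻)) (cong suc (∣⊕∣ x∉))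

⊕-comm : ∀ {m} (S : Subset m) x y → S ⊕ x ⊕ y ≡ S ⊕ y ⊕ x
⊕-comm S x y = trans (∪-assoc S _ _) (trans (cong (S ∪_) (∪-comm ⁅ x ⁆ ⁅ y ⁆)) (sym (∪-assoc S _ _)))

x∈p─q⇒x∉q : ∀ {m} (p q : Subset m) {x} → x ∈ p ─ q → x ∉ q
x∈p─q⇒x∉q (_ ∷ p) (inside  ∷ q) (there x∈) (there x∈q) = x∈p─q⇒x∉q p q x∈ x∈q
x∈p─q⇒x∉q (_ ∷ p) (outside ∷ q) (there x∈) (there x∈q) = x∈p─q⇒x∉q p q x∈ x∈q

⊕⊕-comm : ∀ {m} (S : Subset m) x y z w → S ⊕ x ⊕ y ⊕ z ⊕ w ≡ S ⊕ z ⊕ w ⊕ x ⊕ y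
⊕⊕-comm S x y z w = trans (cong (_⊕ w) (move y)) (trans (⊕-comm (S ⊕ x ⊕ z) y w)
  (trans (cong (λ R → R ⊕ w ⊕ y) (⊕-comm S x z)) (cong (_⊕ y) (⊕-comm (S ⊕ z) x w))))
  where
  move : ∀ y → S ⊕ x ⊕ y ⊕ z ≡ S ⊕ x ⊕ z ⊕ y
  move y = ⊕-comm (S ⊕ x) y z

fresh : ∀ {m} {S T : Subset m} → ∣ S ∣ < ∣ T ∣ → ∃ λ x → x ∈ T × x ∉ S
fresh {S = S} {T} lt with any? (λ x → x ∈? T ×-dec ¬? (x ∈? S))
... | yes found = found
... | no none   = contradiction (≤-trans lt (p⊆q⇒∣p∣≤∣q∣ λ {x} x∈T →
  decidable-stable (x ∈? S) λ x∉S → none (x , x∈T , x∉S))) (<-irrefl refl)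

dbl : ℕ → ℕ
dbl zero    = 0
dbl (suc k) = suc (suc (dbl k))

halve : ∀ k → ∃ λ j → k ≡ dbl j ⊎ k ≡ suc (dbl j)
halve zero = 0 , inj₁ refl
halve (suc k) with halve k
... | j , inj₁ refl = j , inj₂ refl
... | j , inj₂ refl = suc j , inj₁ refl

shift : ∀ k {a b} → b ≡ 2 + a → suc (suc k) + a ≡ k + b
shift k refl = sym (trans (+-suc k _) (cong suc (+-suc k _)))

-- The form `D`, splits and prime sets.

module Splits {m : ℕ} (g : Fin m → Fin m → Bool) (g-sym : ∀ x y → g x y ≡ g y x) where

  opaque
    -- Over the two-element field this pairs a + b with c + d under the bilinear form `g`;
    -- additivity in each pair and symmetry carry all later computations.
    D : (a b c d : Fin m) → Bool
    D a b c d = (g a c xor g b c) xor (g a d xor g b d)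

    private
      D-add : ∀ a b e c d → D a b c d xor D b e c d ≡ D a e c d
      D-add a b e c d = solve 6 (λ ac bc ec ad bd ed →
          ((ac :+ bc) :+ (ad :+ bd)) :+ ((bc :+ ec) :+ (bd :+ ed)) := (ac :+ ec) :+ (ad :+ ed))
        refl (g a c) (g b c) (g e c) (g a d) (g b d) (g e d)
        where open xor-∧-Solver

      D-swap : ∀ a b c d → D a b c d ≡ D c d a b
      D-swap a b c d rewrite g-sym c a | g-sym d a | g-sym c b | g-sym d b =
        solve 4 (λ ac bc ad bd → (ac :+ bc) :+ (ad :+ bd) := (ac :+ ad) :+ (bc :+ bd))
          refl (g a c) (g b c) (g a d) (g b d)
        where open xor-∧-Solver

    D-refl : ∀ a c d → D a a c d ≡ false
    D-refl a c d = solve 2 (λ ac ad → (ac :+ ac) :+ (ad :+ ad) := con false) refl (g a c) (g a d)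
      where open xor-∧-Solver

    -- The three terms are the three ways of pairing off four elements, and each of the six entries
    -- of `g` occurs in exactly two of them.
    D-cyclic : ∀ a b c d → D a b c d xor D b c a d xor D c a b d ≡ false
    D-cyclic a b c d rewrite g-sym b a | g-sym c a | g-sym c b =
      solve 6 (λ ab ac ad bc bd cd →
          ((ac :+ bc) :+ (ad :+ bd)) :+ (((ab :+ ac) :+ (bd :+ cd)) :+ ((bc :+ ab) :+ (cd :+ ad))) := con false)
        refl (g a b) (g a c) (g a d) (g b c) (g b d) (g c d)
      where open xor-∧-Solver

    rows-agree⁺ : ∀ {a b c d} → g a c ≡ g b c → g a d ≡ g b d → D a b c d ≡ false
    rows-agree⁺ {a} {b} {c} {d} p q = cong₂ _xor_ (cancel p) (cancel q)
      where
      cancel : ∀ {s t} → s ≡ t → s xor t ≡ false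
      cancel {s} refl = xor-same s

    rows-agree⁻ : ∀ {a b c d} → g a d ≡ g b d → D a b c d ≡ false → g a c ≡ g b c
    rows-agree⁻ {a} {b} {c} {d} p q = xor-false _ _ (xor-false _ false q′)
      where
      xor-false : ∀ s t → s xor t ≡ false → s ≡ t
      xor-false false false _ = refl
      xor-false true  true  _ = refl
      q′ : (g a c xor g b c) xor false ≡ false
      q′ = trans (cong ((g a c xor g b c) xor_) (sym (trans (cong (_xor g b d) p) (xor-same (g b d))))) q

  swap : ∀ {a b c d s} → D a b c d ≡ s → D c d a b ≡ s
  swap p = trans (D-swap _ _ _ _) p

  chain : ∀ {a b e c d s t} → D a b c d ≡ s → D b e c d ≡ t → D a e c d ≡ s xor t
  chain p q = trans (sym (D-add _ _ _ _ _)) (cong₂ _xor_ p q)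

  chainʳ : ∀ {a b c d e s t} → D a b c d ≡ s → D a b d e ≡ t → D a b c e ≡ s xor t
  chainʳ p q = swap (chain (swap p) (swap q))

  flip : ∀ {a b c d s} → D a b c d ≡ s → D b a c d ≡ s
  flip {a} {b} {c} {d} {s} p with D b a c d in q
  ... | t = helper t s (trans (sym (chain q p)) (D-refl b c d))
    where
    helper : ∀ t s → t xor s ≡ false → t ≡ s
    helper false false _ = refl
    helper true true _ = refl

  flipʳ : ∀ {a b c d s} → D a b c d ≡ s → D a b d c ≡ s
  flipʳ p = swap (flip (swap p))

  Split : Subset m → (Fin m → Set) → Set
  Split S A = ∀ {a b c d} → a ∈ S → b ∈ S → c ∈ S → d ∈ S →
              A a → A b → ¬ A c → ¬ A d → D a b c d ≡ false

  Many : Subset m → (Fin m → Set) → Set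
  Many S A = ∃₂ λ a b → a ∈ S × b ∈ S × a ≢ b × A a × A b

  Prime : Subset m → Set₁
  Prime S = ∀ (A : Fin m → Set) → Decidable A → Split S A → Many S A → ¬ Many S (¬_ ∘ A)

  many? : ∀ S {A} → Decidable A → Dec (Many S A)
  many? S A? = any? λ a → any? λ b →
    a ∈? S ×-dec b ∈? S ×-dec ¬? (a ≟ b) ×-dec A? a ×-dec A? b

  split? : ∀ S {A} → Decidable A → Dec (Split S A)
  split? S A? = map′ (λ f {a} {b} {c} {d} → f a b c d) (λ f a b c d → f {a} {b} {c} {d})
    (all? λ a → all? λ b → all? λ c → all? λ d →
      a ∈? S →-dec (b ∈? S →-dec (c ∈? S →-dec (d ∈? S →-dec
      (A? a →-dec (A? b →-dec (¬? (A? c) →-dec (¬? (A? d) →-dec D a b c d ≟ᵇ false))))))))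

  Splitting : Subset m → Set
  Splitting S = ∃ λ (A : Subset m) → Split S (_∈ A) × Many S (_∈ A) × Many S (_∉ A)

  splitting? : ∀ S → Dec (Splitting S)
  splitting? S = anySubset? λ A →
    split? S (_∈? A) ×-dec many? S (_∈? A) ×-dec many? S (¬? ∘ (_∈? A))

  -- Replaces the predicates in `Prime` by subsets, which makes primality decidable.
  unsplit⇒prime : ∀ {S} → ¬ Splitting S → Prime S
  unsplit⇒prime none _ A? sp (a , b , a∈ , b∈ , a≢b , Aa , Ab) (c , d , c∈ , d∈ , c≢d , ¬Ac , ¬Ad) =
    none (fromPred A?
      , (λ a∈ b∈ c∈ d∈ Aa Ab ¬Ac ¬Ad →
           sp a∈ b∈ c∈ d∈ (∈-fromPred⁻ A? Aa) (∈-fromPred⁻ A? Ab) (¬Ac ∘ ∈-fromPred⁺ A?) (¬Ad ∘ ∈-fromPred⁺ A?))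
      , (a , b , a∈ , b∈ , a≢b , ∈-fromPred⁺ A? Aa , ∈-fromPred⁺ A? Ab)
      , (c , d , c∈ , d∈ , c≢d , ¬Ac ∘ ∈-fromPred⁻ A? , ¬Ad ∘ ∈-fromPred⁻ A?))

  prime? : ∀ S → Dec (Prime S)
  prime? S = map′ unsplit⇒prime (λ pr (A , sp , m₁ , m₂) → pr _ (_∈? A) sp m₁ m₂) (¬? (splitting? S))

  splitting : ∀ {S} → ¬ Prime S → Splitting S
  splitting {S} ¬pr with splitting? S
  ... | yes sp  = sp
  ... | no none = contradiction (unsplit⇒prime none) ¬pr

  AtMostOne : Subset m → (Fin m → Set) → Set
  AtMostOne S A = ∀ {c d} → c ∈ S → d ∈ S → A c → A d → c ≡ d

  ¬many⇒atMostOne : ∀ {S A} → ¬ Many S A → AtMostOne S A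
  ¬many⇒atMostOne none {c} {d} c∈ d∈ Ac Ad =
    decidable-stable (c ≟ d) λ c≢d → none (c , d , c∈ , d∈ , c≢d , Ac , Ad)

  -- Restricted to the prime set `S`, a split of `S′` has a side with at most one element in `S`;
  -- exchanging the sides if necessary makes it `A`.
  thin-splitting : ∀ {S S′} → Prime S → S ⊆ S′ → ¬ Prime S′ →
    ∃ λ (A : Subset m) → Split S′ (_∈ A) × Many S′ (_∈ A) × AtMostOne S (_∈ A)
  thin-splitting {S} pr S⊆S′ ¬pr′ with splitting ¬pr′
  ... | A , sp , m₁ , (c , d , c∈ , d∈ , c≢d , c∉A , d∉A) with many? S (_∈? A)
  ... | no few = A , sp , m₁ , ¬many⇒atMostOne few
  ... | yes many = ∁ A
      , (λ a∈ b∈ c∈ d∈ a∉ b∉ c∈A d∈A →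
           swap (sp c∈ d∈ a∈ b∈ (x∉∁p⇒x∈p c∈A) (x∉∁p⇒x∈p d∈A) (x∈∁p⇒x∉p a∉) (x∈∁p⇒x∉p b∉)))
      , (c , d , c∈ , d∈ , c≢d , x∉p⇒x∈∁p c∉A , x∉p⇒x∈∁p d∉A)
      , λ c∈ d∈ c∉ d∉ → ¬many⇒atMostOne
          (pr _ (_∈? A) (λ a∈ b∈ c∈ d∈ → sp (S⊆S′ a∈) (S⊆S′ b∈) (S⊆S′ c∈) (S⊆S′ d∈)) many)
          c∈ d∈ (x∈∁p⇒x∉p c∉) (x∈∁p⇒x∉p d∉)

  -- By additivity of `D`, it is enough to compare each element of `A` with one fixed `u`.
  star-split : ∀ {S A} u →
    (∀ {a c d} → a ∈ S → A a → c ∈ S → d ∈ S → ¬ A c → ¬ A d → D a u c d ≡ false) → Split S A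
  star-split u h a∈ b∈ c∈ d∈ Aa Ab ¬Ac ¬Ad =
    chain (h a∈ Aa c∈ d∈ ¬Ac ¬Ad) (flip (h b∈ Ab c∈ d∈ ¬Ac ¬Ad))

  -- Twins over a prime set.

  -- Guarantees two elements on the other side once a pair is removed; four elements are enough
  -- (`4≤⇒big`).
  Big : Subset m → Set
  Big S = ∀ u v → ∃₂ λ c d → c ∈ S × d ∈ S × c ≢ d × (c ≢ u × c ≢ v) × (d ≢ u × d ≢ v)

  big-⊆ : ∀ {S S′} → S ⊆ S′ → Big S → Big S′
  big-⊆ S⊆S′ big u v with big u v
  ... | c , d , c∈ , d∈ , rest = c , d , S⊆S′ c∈ , S⊆S′ d∈ , rest

  -- {z , u} is one side of a split of S ∪ {z}; for z ∈ S and S prime this means z ≡ u.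
  record Twin (S : Subset m) (z u : Fin m) : Set where
    constructor mkTwin
    field twin : ∀ {c d} → c ∈ S → d ∈ S → c ≢ u → d ≢ u → D z u c d ≡ false
  open Twin public

  twin? : ∀ S z u → Dec (Twin S z u)
  twin? S z u = map′ (λ f → mkTwin λ {c} {d} → f c d) (λ t c d → twin t {c} {d})
    (all? λ c → all? λ d → c ∈? S →-dec (d ∈? S →-dec
      (¬? (c ≟ u) →-dec (¬? (d ≟ u) →-dec D z u c d ≟ᵇ false))))

  twin-refl : ∀ {S} u → Twin S u u
  twin-refl u = mkTwin λ _ _ _ _ → D-refl u _ _

  twin-⊆ : ∀ {S S′ z u} → S ⊆ S′ → Twin S′ z u → Twin S z u
  twin-⊆ S⊆S′ t = mkTwin λ c∈ d∈ → twin t (S⊆S′ c∈) (S⊆S′ d∈)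

  twins⇒¬prime : ∀ {S z u} → Big S → z ∈ S → u ∈ S → z ≢ u →
    (∀ {c d} → c ∈ S → d ∈ S → c ≢ z → c ≢ u → d ≢ z → d ≢ u → D z u c d ≡ false) → ¬ Prime S
  twins⇒¬prime {S} {z} {u} big z∈ u∈ z≢u h pr with big z u
  ... | c , d , c∈ , d∈ , c≢d , (c≢z , c≢u) , (d≢z , d≢u) =
    pr _ (λ x → x ≟ z ⊎-dec x ≟ u) (star-split u λ where
          _ (inj₁ refl) c∈ d∈ ¬c ¬d → h c∈ d∈ (¬c ∘ inj₁) (¬c ∘ inj₂) (¬d ∘ inj₁) (¬d ∘ inj₂)
          _ (inj₂ refl) _ _ _ _     → D-refl u _ _)
       (z , u , z∈ , u∈ , z≢u , inj₁ refl , inj₂ refl)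
       (c , d , c∈ , d∈ , c≢d , [ c≢z , c≢u ]′ , [ d≢z , d≢u ]′)

  two-two⇒¬prime : ∀ {S a b c d} → a ∈ S → b ∈ S → c ∈ S → d ∈ S → a ≢ b → c ≢ d →
    c ≢ a → c ≢ b → d ≢ a → d ≢ b → (∀ {x} → x ∈ S → x ≡ a ⊎ x ≡ b ⊎ x ≡ c ⊎ x ≡ d) →
    D a b c d ≡ false → ¬ Prime S
  two-two⇒¬prime {S} {a} {b} {c} {d} a∈ b∈ c∈ d∈ a≢b c≢d c≢a c≢b d≢a d≢b only p pr =
    pr A (λ x → x ≟ a ⊎-dec x ≟ b) (star-split b λ where
          _ (inj₁ refl) x∈ y∈ ¬Ax ¬Ay → apart (outer x∈ ¬Ax) (outer y∈ ¬Ay)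
          _ (inj₂ refl) _ _ _ _ → D-refl b _ _)
       (a , b , a∈ , b∈ , a≢b , inj₁ refl , inj₂ refl)
       (c , d , c∈ , d∈ , c≢d , [ c≢a , c≢b ]′ , [ d≢a , d≢b ]′)
    where
    A : Fin m → Set
    A x = x ≡ a ⊎ x ≡ b
    outer : ∀ {x} → x ∈ S → ¬ A x → x ≡ c ⊎ x ≡ d
    outer x∈ ¬Ax with only x∈
    ... | inj₁ q        = contradiction (inj₁ q) ¬Ax
    ... | inj₂ (inj₁ q) = contradiction (inj₂ q) ¬Ax
    ... | inj₂ (inj₂ q) = q
    apart : ∀ {x y} → x ≡ c ⊎ x ≡ d → y ≡ c ⊎ y ≡ d → D a b x y ≡ false
    apart (inj₁ refl) (inj₁ refl) = swap (D-refl _ _ _)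
    apart (inj₁ refl) (inj₂ refl) = p
    apart (inj₂ refl) (inj₁ refl) = flipʳ p
    apart (inj₂ refl) (inj₂ refl) = swap (D-refl _ _ _)

  -- Two different twins of `z` would be twins of each other, and a pair of twins inside `S` is one
  -- side of a split.
  twin-unique : ∀ {S z u v} → Big S → Prime S → u ∈ S → v ∈ S → Twin S z u → Twin S z v → u ≡ v
  twin-unique {S} {z} {u} {v} big pr u∈ v∈ tu tv = decidable-stable (u ≟ v) λ u≢v →
    twins⇒¬prime big u∈ v∈ u≢v
      (λ c∈ d∈ c≢u c≢v d≢u d≢v → chain (flip (twin tu c∈ d∈ c≢u d≢u)) (twin tv c∈ d∈ c≢v d≢v)) pr

  -- The middle element `t` may lie outside `S`; if it lies inside, uniqueness forces it to be `u`.
  twin-trans : ∀ {S S′ z t u} → Big S → Prime S → S ⊆ S′ → u ∈ S → Twin S′ z t → Twin S t u → Twin S z u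
  twin-trans {S} {t = t} {u} big pr S⊆S′ u∈ tz tt =
    mkTwin λ c∈ d∈ c≢u d≢u →
      chain (twin tz (S⊆S′ c∈) (S⊆S′ d∈) (t≢ c∈ c≢u) (t≢ d∈ d≢u)) (twin tt c∈ d∈ c≢u d≢u)
    where
    t≢ : ∀ {c} → c ∈ S → c ≢ u → c ≢ t
    t≢ c∈ c≢u refl = c≢u (twin-unique big pr c∈ u∈ (twin-refl t) tt)

  -- As `t` is outside `S`, the pair `w`, `t` can be compared on all of `S`, and additivity replaces
  -- `w` by `t`.
  twin-join : ∀ {S S′ w t u} → S ⊆ S′ → t ∉ S → Twin S′ w t → Twin S w u → Twin S t u
  twin-join {S} {t = t} S⊆S′ t∉ wt wu = mkTwin λ c∈ d∈ c≢u d≢u →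
    chain (flip (twin wt (S⊆S′ c∈) (S⊆S′ d∈) (≢t c∈) (≢t d∈))) (twin wu c∈ d∈ c≢u d≢u)
    where
    ≢t : ∀ {c} → c ∈ S → c ≢ t
    ≢t c∈ refl = t∉ c∈

  split⇒twin : ∀ {S S′ A z t} → S ⊆ S′ → Split S′ A → AtMostOne S A → z ∈ S′ → A z → t ∈ S → A t → Twin S z t
  split⇒twin S⊆S′ sp few z∈ Az t∈ At = mkTwin λ c∈ d∈ c≢t d≢t →
    sp z∈ (S⊆S′ t∈) (S⊆S′ c∈) (S⊆S′ d∈) Az At (λ Ac → c≢t (few c∈ t∈ Ac At)) (λ Ad → d≢t (few d∈ t∈ Ad At))

  -- Adding one or two elements to a prime set.

  -- The thin side has two elements but at most one in `S`, so it consists of `z` and its twin.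
  attach : ∀ {S z} → Prime S → ¬ Prime (S ⊕ z) → ∃ λ u → u ∈ S × Twin S z u
  attach {S} {z} pr ¬pr with thin-splitting pr ⊕⁺ ¬pr
  ... | A , sp , (a , b , a∈ , b∈ , a≢b , Aa , Ab) , few with ⊕⁻ a∈ | ⊕⁻ b∈
  ... | inj₁ a∈S  | inj₁ b∈S  = contradiction (few a∈S b∈S Aa Ab) a≢b
  ... | inj₁ a∈S  | inj₂ refl = a , a∈S , split⇒twin ⊕⁺ sp few b∈ Ab a∈S Aa
  ... | inj₂ refl | inj₁ b∈S  = b , b∈S , split⇒twin ⊕⁺ sp few a∈ Aa b∈S Ab
  ... | inj₂ refl | inj₂ refl = contradiction refl a≢b

  two-of : ∀ {S z w A} → AtMostOne S A → Many (S ⊕ z ⊕ w) A →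
    (∃ λ t → t ∈ S × A t × (A z ⊎ A w)) ⊎ (A z × A w)
  two-of few (a , b , a∈ , b∈ , a≢b , Aa , Ab) with ⊕⊕⁻ a∈ | ⊕⊕⁻ b∈
  ... | inj₁ a∈S         | inj₁ b∈S         = contradiction (few a∈S b∈S Aa Ab) a≢b
  ... | inj₁ a∈S         | inj₂ (inj₁ refl) = inj₁ (a , a∈S , Aa , inj₁ Ab)
  ... | inj₁ a∈S         | inj₂ (inj₂ refl) = inj₁ (a , a∈S , Aa , inj₂ Ab)
  ... | inj₂ (inj₁ refl) | inj₁ b∈S         = inj₁ (b , b∈S , Ab , inj₁ Aa)
  ... | inj₂ (inj₁ refl) | inj₂ (inj₁ refl) = contradiction refl a≢b
  ... | inj₂ (inj₁ refl) | inj₂ (inj₂ refl) = inj₂ (Aa , Ab)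
  ... | inj₂ (inj₂ refl) | inj₁ b∈S         = inj₁ (b , b∈S , Ab , inj₂ Aa)
  ... | inj₂ (inj₂ refl) | inj₂ (inj₁ refl) = inj₂ (Ab , Aa)
  ... | inj₂ (inj₂ refl) | inj₂ (inj₂ refl) = contradiction refl a≢b

  -- The thin side cannot contain both `z` and `w`, or `w` would be a twin of `u`. So it is either
  -- `z` with `u`, or `w` with some `t` different from `u`, and each makes `z` and `u` agree towards
  -- `w` as well.
  twin-extends : ∀ {S z w u} → Big S → Prime S → u ∈ S → Twin S z u → ¬ Twin S w u →
    ¬ Prime (S ⊕ z ⊕ w) → Twin (S ⊕ w) z u
  twin-extends {S} {z} {w} {u} big pr u∈ tz ¬tw ¬pr with thin-splitting pr (⊕⁺ ∘ ⊕⁺) ¬pr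
  ... | A , sp , many , few = result
    where
    S⊆ : S ⊆ S ⊕ z ⊕ w
    S⊆ = ⊕⁺ ∘ ⊕⁺

    z∈ : z ∈ S ⊕ z ⊕ w
    z∈ = ⊕⁺ ⊕-new

    alone : z ∈ A → ∀ {c} → c ∈ S → c ≢ u → c ∉ A
    alone z∈A c∈ c≢u c∈A = c≢u (twin-unique big pr c∈ u∈ (split⇒twin S⊆ sp few z∈ z∈A c∈ c∈A) tz)

    case-in : z ∈ A → w ∉ A → u ∈ A → Twin (S ⊕ w) z u
    case-in z∈A w∉A u∈A = mkTwin λ c∈ d∈ c≢u d≢u →
      sp z∈ (S⊆ u∈) (up c∈) (up d∈) z∈A u∈A (out c∈ c≢u) (out d∈ d≢u)
      where
      up : ∀ {c} → c ∈ S ⊕ w → c ∈ S ⊕ z ⊕ w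
      up c∈ with ⊕⁻ c∈
      ... | inj₁ p    = S⊆ p
      ... | inj₂ refl = ⊕-new
      out : ∀ {c} → c ∈ S ⊕ w → c ≢ u → c ∉ A
      out c∈ c≢u with ⊕⁻ c∈
      ... | inj₁ p    = alone z∈A p c≢u
      ... | inj₂ refl = w∉A

    case-out : ∀ {t} → t ∈ S → t ∈ A → z ∉ A → w ∈ A → Twin (S ⊕ w) z u
    case-out {t} t∈ t∈A z∉A w∈A = mkTwin λ c∈ d∈ c≢u d≢u →
        chainʳ (to-t c∈ c≢u) (flipʳ (to-t d∈ d≢u))
      where
      t≢u : t ≢ u
      t≢u refl = ¬tw (split⇒twin S⊆ sp few ⊕-new w∈A t∈ t∈A)
      to-t : ∀ {c} → c ∈ S ⊕ w → c ≢ u → D z u c t ≡ false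
      to-t c∈ c≢u with ⊕⁻ c∈
      ... | inj₁ p    = twin tz p t∈ c≢u t≢u
      ... | inj₂ refl = swap (sp ⊕-new (S⊆ t∈) z∈ (S⊆ u∈) w∈A t∈A z∉A
                                (λ u∈A → t≢u (few t∈ u∈ t∈A u∈A)))

    both : z ∈ A → w ∉ A
    both z∈A w∈A = ¬tw (mkTwin λ c∈ d∈ c≢u d≢u →
      chain (flip (sp z∈ ⊕-new (S⊆ c∈) (S⊆ d∈) z∈A w∈A (alone z∈A c∈ c≢u) (alone z∈A d∈ d≢u)))
            (twin tz c∈ d∈ c≢u d≢u))

    result : Twin (S ⊕ w) z u
    result with two-of few many | z ∈? A
    ... | inj₂ (z∈A , w∈A) | _ = contradiction w∈A (both z∈A)
    ... | inj₁ (t , t∈ , t∈A , inj₁ z∈A) | no z∉A = contradiction z∈A z∉A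
    ... | inj₁ (t , t∈ , t∈A , inj₂ w∈A) | no z∉A = case-out t∈ t∈A z∉A w∈A
    ... | inj₁ (t , t∈ , t∈A , _) | yes z∈A with t ≟ u
    ...   | yes refl = case-in z∈A (both z∈A) t∈A
    ...   | no t≢u   = contradiction t∈A (alone z∈A t∈ t≢u)

  -- With no twins in `S` available, the thin side is exactly `z` and `w`.
  untwinned : ∀ {S z w} → Prime S → (∀ {u} → u ∈ S → ¬ Twin S z u) → (∀ {u} → u ∈ S → ¬ Twin S w u) →
    ¬ Prime (S ⊕ z ⊕ w) → ∀ {c d} → c ∈ S → d ∈ S → D z w c d ≡ false
  untwinned {S} {z} {w} pr ¬tz ¬tw ¬pr c∈ d∈ with thin-splitting pr (⊕⁺ ∘ ⊕⁺) ¬pr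
  ... | A , sp , many , few with two-of few many
  ... | inj₁ (t , t∈ , t∈A , inj₁ z∈A) =
    contradiction (split⇒twin (⊕⁺ ∘ ⊕⁺) sp few (⊕⁺ ⊕-new) z∈A t∈ t∈A) (¬tz t∈)
  ... | inj₁ (t , t∈ , t∈A , inj₂ w∈A) =
    contradiction (split⇒twin (⊕⁺ ∘ ⊕⁺) sp few ⊕-new w∈A t∈ t∈A) (¬tw t∈)
  ... | inj₂ (z∈A , w∈A) = sp (⊕⁺ ⊕-new) ⊕-new (⊕⁺ (⊕⁺ c∈)) (⊕⁺ (⊕⁺ d∈)) z∈A w∈A (out c∈) (out d∈)
    where
    out : ∀ {c} → c ∈ S → c ∉ A
    out c∈ c∈A = ¬tz c∈ (split⇒twin (⊕⁺ ∘ ⊕⁺) sp few (⊕⁺ ⊕-new) z∈A c∈ c∈A)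

  -- The Ehrenfeucht–Rozenberg theorem.
  two-step : ∀ {S T} → Big S → Prime S → S ⊆ T → Prime T →
    (∃₂ λ z w → z ∈ T × w ∈ T × z ∉ S × w ∉ S × z ≢ w) →
    ∃₂ λ z w → z ∈ T × w ∈ T × z ∉ S × w ∉ S × z ≢ w × Prime (S ⊕ z ⊕ w)
  two-step {S} {T} big pr S⊆T prT (p , q , p∈ , q∈ , p∉ , q∉ , p≢q)
    with any? (λ z → any? λ w → z ∈? T ×-dec w ∈? T ×-dec ¬? (z ∈? S) ×-dec ¬? (w ∈? S)
                 ×-dec ¬? (z ≟ w) ×-dec prime? (S ⊕ z ⊕ w))
  ... | yes found = found
  ... | no none with any? (λ z → any? λ u → z ∈? T ×-dec ¬? (z ∈? S) ×-dec u ∈? S ×-dec twin? S z u)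
  -- If no pair extends `S`, then `u` with all its twins outside `S` is one side of a split of `T`:
  -- by `twin-extends` such a twin agrees with `u` towards every element outside this class.
  ...   | yes (z , u , z∈ , z∉ , u∈ , tz) = Empty.⊥-elim
    (prT A (λ x → x ≟ u ⊎-dec ¬? (x ∈? S) ×-dec twin? S x u) (star-split u star)
      (z , u , z∈ , S⊆T u∈ , (λ { refl → z∉ u∈ }) , inj₂ (z∉ , tz) , inj₁ refl)
      many)
    where
    A : Fin m → Set
    A x = x ≡ u ⊎ (x ∉ S × Twin S x u)

    ∈S⇒¬A : ∀ {c} → c ∈ S → c ≢ u → ¬ A c
    ∈S⇒¬A c∈ c≢u (inj₁ c≡u)      = c≢u c≡u
    ∈S⇒¬A c∈ c≢u (inj₂ (c∉ , _)) = c∉ c∈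

    many : Many T (¬_ ∘ A)
    many with big u u
    ... | c , d , c∈ , d∈ , c≢d , (c≢u , _) , (d≢u , _) =
      c , d , S⊆T c∈ , S⊆T d∈ , c≢d , ∈S⇒¬A c∈ c≢u , ∈S⇒¬A d∈ d≢u

    star : ∀ {a c d} → a ∈ T → A a → c ∈ T → d ∈ T → ¬ A c → ¬ A d → D a u c d ≡ false
    star a∈ (inj₁ refl) _ _ _ _ = D-refl _ _ _
    star {a} a∈ (inj₂ (a∉ , ta)) c∈ d∈ ¬Ac ¬Ad with big u u
    ... | e , _ , e∈ , _ , _ , (e≢u , _) , _ = chainʳ (to-e c∈ ¬Ac) (flipʳ (to-e d∈ ¬Ad))
      where
      to-e : ∀ {c} → c ∈ T → ¬ A c → D a u c e ≡ false
      to-e {c} c∈ ¬Ac with c ∈? S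
      ... | yes c∈S = twin ta c∈S e∈ (¬Ac ∘ inj₁) e≢u
      ... | no c∉S  = twin
        (twin-extends big pr u∈ ta (λ tc → ¬Ac (inj₂ (c∉S , tc)))
          (λ prime → none (a , c , a∈ , c∈ , a∉ , c∉S , (λ { refl → ¬Ac (inj₂ (a∉ , ta)) }) , prime)))
        ⊕-new (⊕⁺ e∈) (¬Ac ∘ inj₁) e≢u
  -- If nothing outside `S` has a twin in `S`, then by `untwinned` the complement of `S` is one side
  -- of a split of `T`.
  ...   | no ¬twins with big p p
  ...     | e , f , e∈ , f∈ , e≢f , _ = Empty.⊥-elim
    (prT (_∉ S) (λ x → ¬? (x ∈? S)) sp (p , q , p∈ , q∈ , p≢q , p∉ , q∉)
      (e , f , S⊆T e∈ , S⊆T f∈ , e≢f , contradiction e∈ , contradiction f∈))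
    where
    sp : Split T (_∉ S)
    sp {a} {b} {c} {d} a∈ b∈ c∈ d∈ a∉ b∉ ¬c∉ ¬d∉ with a ≟ b
    ... | yes refl = D-refl a _ _
    ... | no a≢b   = untwinned pr (λ u∈ t → ¬twins (a , _ , a∈ , a∉ , u∈ , t))
      (λ u∈ t → ¬twins (b , _ , b∈ , b∉ , u∈ , t))
      (λ prime → none (a , b , a∈ , b∈ , a∉ , b∉ , a≢b , prime))
      (decidable-stable (c ∈? S) ¬c∉) (decidable-stable (d ∈? S) ¬d∉)

  clash : ∀ {b a} {A : Set a} → b ≡ true → b ≡ false → A
  clash p q with () ← trans (sym p) q

  -- Prime sets of odd codimension, and edges over them.

  module Codimension (T : Subset m) (primeT : Prime T) (X : Subset m) (bigX : Big X)
    (codim≢2 : ∀ {S} → X ⊆ S → S ⊆ T → Prime S → ∣ T ∣ ≢ 2 + ∣ S ∣) where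

    ⊕⊕⊆T : ∀ {S x y} → S ⊆ T → x ∈ T → y ∈ T → S ⊕ x ⊕ y ⊆ T
    ⊕⊕⊆T S⊆T x∈ y∈ z∈ with ⊕⊕⁻ z∈
    ... | inj₁ p           = S⊆T p
    ... | inj₂ (inj₁ refl) = x∈
    ... | inj₂ (inj₂ refl) = y∈

    prime-step : ∀ {S} → X ⊆ S → S ⊆ T → Prime S → 2 + ∣ S ∣ ≤ ∣ T ∣ →
      ∃₂ λ z w → z ∈ T × w ∈ T × z ∉ S × w ∉ S × z ≢ w × Prime (S ⊕ z ⊕ w) × ∣ S ⊕ z ⊕ w ∣ ≡ 2 + ∣ S ∣
    prime-step {S} X⊆S S⊆T pr room with fresh {S = S} {T} (≤-trans (m≤n⇒m≤1+n ≤-refl) room)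
    ... | p , p∈ , p∉ with fresh {S = S ⊕ p} {T} (subst (λ c → suc c ≤ ∣ T ∣) (sym (∣⊕∣ p∉)) room)
    ... | q , q∈ , q∉ with two-step (big-⊆ X⊆S bigX) pr S⊆T primeT
                           (p , q , p∈ , q∈ , p∉ , q∉ ∘ ⊕⁺ , λ { refl → q∉ ⊕-new })
    ... | z , w , z∈ , w∈ , z∉ , w∉ , z≢w , prime =
      z , w , z∈ , w∈ , z∉ , w∉ , z≢w , prime , ∣⊕⊕∣ z∉ w∉ z≢w

    -- `two-step` lowers the codimension by two until it reaches the forbidden value 2.
    even-codim : ∀ k {S} → X ⊆ S → S ⊆ T → Prime S → ∣ T ∣ ≢ dbl (suc k) + ∣ S ∣
    even-codim zero X⊆S S⊆T pr card = codim≢2 X⊆S S⊆T pr card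
    even-codim (suc k) X⊆S S⊆T pr card
      with prime-step X⊆S S⊆T pr (≤-trans (s≤s (s≤s (m≤n+m _ (dbl (suc k))))) (≤-reflexive (sym card)))
    ... | z , w , z∈ , w∈ , _ , _ , _ , pr′ , card′ =
      even-codim k (⊕⁺ ∘ ⊕⁺ ∘ X⊆S) (⊕⊕⊆T S⊆T z∈ w∈) pr′ (trans card (shift (dbl (suc k)) card′))

    -- Level `k` is codimension 2k + 1: adding an edge lowers the level by one, and level 3 is the
    -- codimension 7 to be excluded.
    record Level (k : ℕ) (S : Subset m) : Set₁ where
      constructor mkLevel
      field
        base  : X ⊆ S
        sub   : S ⊆ T
        prime : Prime S
        codim : ∣ T ∣ ≡ suc (dbl k) + ∣ S ∣

      big : Big S
      big = big-⊆ base bigX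

      unique : ∀ {z u v} → u ∈ S → v ∈ S → Twin S z u → Twin S z v → u ≡ v
      unique = twin-unique big prime

    open Level

    opaque
      -- For `z` outside `S`, the set `S ⊕ z` has positive even codimension, so it is not prime and
      -- `attach` applies.
      π : ∀ {k S} → Level (suc k) S → ∀ {z} → z ∈ T → ∃ λ u → u ∈ S × Twin S z u
      π {k} {S} L {z} z∈ with z ∈? S
      ... | yes z∈S = z , z∈S , twin-refl z
      ... | no z∉S  = attach (prime L) λ pr →
        even-codim k (⊕⁺ ∘ base L) (λ c∈ → [ sub L , (λ { refl → z∈ }) ]′ (⊕⁻ c∈)) pr
          (trans (codim L) (trans (sym (+-suc (dbl (suc k)) ∣ S ∣)) (cong (dbl (suc k) +_) (sym (∣⊕∣ z∉S)))))

    -- On a set of positive level this amounts to S ∪ {x , y} being prime: see edge⇒level and prime⇒edge.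
    record Edge (S : Subset m) (x y u v : Fin m) : Set where
      constructor mkEdge
      field
        x∈T : x ∈ T
        y∈T : y ∈ T
        u∈S : u ∈ S
        v∈S : v ∈ S
        u≢v : u ≢ v
        tx  : Twin S x u
        ty  : Twin S y v
        adj : D x u y v ≡ true
    open Edge

    edge-sym : ∀ {S x y u v} → Edge S x y u v → Edge S y x v u
    edge-sym (mkEdge x∈ y∈ u∈ v∈ u≢v tx ty adj) = mkEdge y∈ x∈ v∈ u∈ (≢-sym u≢v) ty tx (swap adj)

    x∉ : ∀ {k S x y u v} → Level k S → Edge S x y u v → x ∉ S
    x∉ L e x∈ with refl ← unique L x∈ (u∈S e) (twin-refl _) (tx e) = clash (adj e) (D-refl _ _ _)

    y∉ : ∀ {k S x y u v} → Level k S → Edge S x y u v → y ∉ S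
    y∉ L e = x∉ L (edge-sym e)

    x≢y : ∀ {k S x y u v} → Level k S → Edge S x y u v → x ≢ y
    x≢y L e refl = u≢v e (unique L (u∈S e) (v∈S e) (tx e) (ty e))

    ∉⇒≢ : ∀ {S : Subset m} {x y} → x ∈ S → y ∉ S → x ≢ y
    ∉⇒≢ x∈ y∉ refl = y∉ x∈

    opaque
      -- Were `S ⊕ x ⊕ y` not prime, `twin-extends` would make `x` a twin of `u` over `S ⊕ y`,
      -- against `adj`.
      edge⇒level : ∀ {k S x y u v} → Level (suc k) S → Edge S x y u v → Level k (S ⊕ x ⊕ y)
      edge⇒level {k} {S} {x} {y} {u} L e = mkLevel (⊕⁺ ∘ ⊕⁺ ∘ base L) (⊕⊕⊆T (sub L) (x∈T e) (y∈T e)) pr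
        (trans (codim L) (shift (suc (dbl k)) (∣⊕⊕∣ (x∉ L e) (y∉ L e) (x≢y L e))))
        where
        pr : Prime (S ⊕ x ⊕ y)
        pr with prime? (S ⊕ x ⊕ y)
        ... | yes p = p
        ... | no ¬p = clash (adj e) (twin
          (twin-extends (big L) (prime L) (u∈S e) (tx e) (λ t → u≢v e (unique L (u∈S e) (v∈S e) t (ty e))) ¬p)
          ⊕-new (⊕⁺ (v∈S e)) (≢-sym (∉⇒≢ (u∈S e) (y∉ L e))) (≢-sym (u≢v e)))

    -- Otherwise there is a split: with side `z`, `u` if the twins differ but `D z u w v` vanishes,
    -- and with side `u`, `z`, `w` if they coincide.
    prime⇒edge : ∀ {k S z w} → Level (suc k) S → z ∈ T → w ∈ T → z ∉ S → w ∉ S → z ≢ w →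
      Prime (S ⊕ z ⊕ w) → ∃₂ λ u v → Edge S z w u v
    prime⇒edge {S = S} {z} {w} L z∈ w∈ z∉ w∉ z≢w pr with π L z∈ | π L w∈
    ... | u , u∈ , tz | v , v∈ , tw with u ≟ v | D z u w v in eq
    ... | no u≢v   | true  = u , v , mkEdge z∈ w∈ u∈ v∈ u≢v tz tw eq
    ... | no u≢v   | false = contradiction pr
      (twins⇒¬prime (big-⊆ (⊕⁺ ∘ ⊕⁺) (big L)) (⊕⁺ ⊕-new) (⊕⁺ (⊕⁺ u∈)) (≢-sym (∉⇒≢ u∈ z∉))
        λ c∈ d∈ c≢z c≢u d≢z d≢u → chainʳ (to-v c∈ c≢z c≢u) (flipʳ (to-v d∈ d≢z d≢u)))
      where
      to-v : ∀ {c} → c ∈ S ⊕ z ⊕ w → c ≢ z → c ≢ u → D z u c v ≡ false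
      to-v c∈ c≢z c≢u with ⊕⊕⁻ c∈
      ... | inj₁ p           = twin tz p v∈ c≢u (≢-sym u≢v)
      ... | inj₂ (inj₁ refl) = contradiction refl c≢z
      ... | inj₂ (inj₂ refl) = eq
    ... | yes refl | _ with big L u u
    ...   | c , d , c∈ , d∈ , c≢d , (c≢u , _) , (d≢u , _) = Empty.⊥-elim
      (pr A (λ a → a ≟ u ⊎-dec a ≟ z ⊎-dec a ≟ w) (star-split u star)
        (z , w , ⊕⁺ ⊕-new , ⊕-new , z≢w , inj₂ (inj₁ refl) , inj₂ (inj₂ refl))
        (c , d , ⊕⁺ (⊕⁺ c∈) , ⊕⁺ (⊕⁺ d∈) , c≢d , ¬A c∈ c≢u , ¬A d∈ d≢u))
      where
      A : Fin m → Set
      A a = a ≡ u ⊎ a ≡ z ⊎ a ≡ w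
      ¬A : ∀ {c} → c ∈ S → c ≢ u → ¬ A c
      ¬A c∈ c≢u (inj₁ c≡u)         = c≢u c≡u
      ¬A c∈ c≢u (inj₂ (inj₁ refl)) = z∉ c∈
      ¬A c∈ c≢u (inj₂ (inj₂ refl)) = w∉ c∈
      in-S : ∀ {c} → c ∈ S ⊕ z ⊕ w → ¬ A c → c ∈ S
      in-S c∈ ¬Ac with ⊕⊕⁻ c∈
      ... | inj₁ p = p
      ... | inj₂ q = contradiction (inj₂ q) ¬Ac
      star : ∀ {a c d} → a ∈ S ⊕ z ⊕ w → A a → c ∈ S ⊕ z ⊕ w → d ∈ S ⊕ z ⊕ w → ¬ A c → ¬ A d →
        D a u c d ≡ false
      star _ (inj₁ refl) _ _ _ _ = D-refl _ _ _
      star _ (inj₂ (inj₁ refl)) c∈ d∈ ¬Ac ¬Ad = twin tz (in-S c∈ ¬Ac) (in-S d∈ ¬Ad) (¬Ac ∘ inj₁) (¬Ad ∘ inj₁)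
      star _ (inj₂ (inj₂ refl)) c∈ d∈ ¬Ac ¬Ad = twin tw (in-S c∈ ¬Ac) (in-S d∈ ¬Ad) (¬Ac ∘ inj₁) (¬Ad ∘ inj₁)

    room : ∀ {k S} → Level (suc k) S → 2 + ∣ S ∣ ≤ ∣ T ∣
    room {k} L = ≤-trans (s≤s (s≤s (m≤n+m _ (suc (dbl k))))) (≤-reflexive (sym (codim L)))

    opaque
      some-edge : ∀ {k S} → Level (suc k) S → ∃₂ λ x y → ∃₂ λ u v → Edge S x y u v
      some-edge L with prime-step (base L) (sub L) (prime L) (room L)
      ... | z , w , z∈ , w∈ , z∉ , w∉ , z≢w , pr , _ = z , w , prime⇒edge L z∈ w∈ z∉ w∉ z≢w pr

    -- How adding an edge refines the blocks of elements with a common twin.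

    -- The twin of z in S ⊕ x ⊕ y, given that its twin in S is t.
    data Block (S : Subset m) (x y u v z t : Fin m) : Set where
      stay : Twin (S ⊕ x ⊕ y) z t → Block S x y u v z t
      at-x : t ≡ u → D z u y v ≡ true → Twin (S ⊕ x ⊕ y) z x → Block S x y u v z t
      at-y : t ≡ v → D z v x u ≡ true → Twin (S ⊕ x ⊕ y) z y → Block S x y u v z t

    old : ∀ {S : Subset m} {x y} → S ⊆ S ⊕ x ⊕ y
    old = ⊕⁺ ∘ ⊕⁺

    new₁ : ∀ {S : Subset m} {x y} → x ∈ S ⊕ x ⊕ y
    new₁ = ⊕⁺ ⊕-new

    -- A twin of `x` over the larger set inherits from `x` both its twin `u` over `S` and its edge
    -- to `y`.
    twin-x⇒adj : ∀ {k S x y u v z} → Level k S → Edge S x y u v →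
      Twin (S ⊕ x ⊕ y) z x → Twin S z u × D z u y v ≡ true
    twin-x⇒adj L e t =
        twin-trans (big L) (prime L) old (u∈S e) t (tx e)
      , chain (twin t ⊕-new (old (v∈S e)) (≢-sym (x≢y L e)) (∉⇒≢ (v∈S e) (x∉ L e))) (adj e)

    twin-comm : ∀ {S x y z t} → Twin (S ⊕ x ⊕ y) z t → Twin (S ⊕ y ⊕ x) z t
    twin-comm {S} {x} {y} {z} {t} = subst (λ R → Twin R z t) (⊕-comm S x y)

    twin-y⇒adj : ∀ {k S x y u v z} → Level k S → Edge S x y u v →
      Twin (S ⊕ x ⊕ y) z y → Twin S z v × D z v x u ≡ true
    twin-y⇒adj L e t = twin-x⇒adj L (edge-sym e) (twin-comm t)

    block : ∀ {k S x y u v z t} → Level (suc (suc k)) S → Edge S x y u v →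
      z ∈ T → t ∈ S → Twin S z t → Block S x y u v z t
    block L e z∈ t∈ tz with π (edge⇒level L e) z∈
    ... | t₁ , t₁∈ , tz₁ with ⊕⊕⁻ t₁∈
    ... | inj₁ p with refl ← unique L t∈ p tz (twin-⊆ old tz₁) = stay tz₁
    ... | inj₂ (inj₁ refl) with twin-x⇒adj L e tz₁
    ...   | tz′ , a = at-x (unique L t∈ (u∈S e) tz tz′) a tz₁
    block L e z∈ t∈ tz | t₁ , t₁∈ , tz₁ | inj₂ (inj₂ refl) with twin-y⇒adj L e tz₁
    ...   | tz′ , a = at-y (unique L t∈ (v∈S e) tz tz′) a tz₁

    stay⇒¬adj : ∀ {k S x y u v z} → Level k S → Edge S x y u v → ∀ {t} → t ∈ S → t ≢ v →
      Twin (S ⊕ x ⊕ y) z t → D z t y v ≡ false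
    stay⇒¬adj L e t∈ t≢v tz = twin tz ⊕-new (old (v∈S e)) (≢-sym (∉⇒≢ t∈ (y∉ L e))) (≢-sym t≢v)

    -- The edge cuts the block of `u` in two: elements adjacent to `y` become twins of `x`, and by
    -- `far` the others keep the twin `u`.
    near : ∀ {k S x y u v z} → Level (suc (suc k)) S → Edge S x y u v → z ∈ T → Twin S z u →
      D z u y v ≡ true → Twin (S ⊕ x ⊕ y) z x
    near L e z∈ tz a with block L e z∈ (u∈S e) tz
    ... | stay t        = clash a (stay⇒¬adj L e (u∈S e) (u≢v e) t)
    ... | at-x _ _ t    = t
    ... | at-y u≡v _ _  = contradiction u≡v (u≢v e)

    far : ∀ {k S x y u v z} → Level (suc (suc k)) S → Edge S x y u v → z ∈ T → Twin S z u →
      D z u y v ≡ false → Twin (S ⊕ x ⊕ y) z u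
    far L e z∈ tz a with block L e z∈ (u∈S e) tz
    ... | stay t       = t
    ... | at-x _ a′ _  = clash a′ a
    ... | at-y u≡v _ _ = contradiction u≡v (u≢v e)

    nearʸ : ∀ {k S x y u v z} → Level (suc (suc k)) S → Edge S x y u v → z ∈ T → Twin S z v →
      D z v x u ≡ true → Twin (S ⊕ x ⊕ y) z y
    nearʸ L e z∈ tz a = twin-comm (near L (edge-sym e) z∈ tz a)

    farʸ : ∀ {k S x y u v z} → Level (suc (suc k)) S → Edge S x y u v → z ∈ T → Twin S z v →
      D z v x u ≡ false → Twin (S ⊕ x ⊕ y) z v
    farʸ L e z∈ tz a = twin-comm (far L (edge-sym e) z∈ tz a)

    -- If `z` were in a block other than those of `u` and `v`, it would keep its twin over
    -- `S ⊕ x ⊕ y` and could not be adjacent to `x`.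
    same-block-of-neighbours : ∀ {k S x y z u v t} → Level (suc (suc k)) S →
      Edge S x y u v → Edge S x z u t → t ≡ v
    same-block-of-neighbours {v = v} {t} L e f = decidable-stable (t ≟ v) λ t≢v →
      case block L e (y∈T f) (v∈S f) (ty f) of λ where
        (stay tz)      → clash (swap (adj f))
          (twin tz new₁ (old (u∈S e)) (≢-sym (∉⇒≢ (v∈S f) (x∉ L e))) (u≢v f))
        (at-x t≡u _ _) → u≢v f (sym t≡u)
        (at-y t≡v _ _) → t≢v t≡v

    private
      -- As `z` also forms an edge with `y`, it can take the place of `x`, and `w` still keeps the
      -- twin `u`. So `D w u x v` and `D w u z v` both vanish, and with them `D w u x z`.
      near-far : ∀ {k S x y u v z w} → Level (suc (suc k)) S → Edge S x y u v → z ∈ T → w ∈ T →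
        Twin (S ⊕ x ⊕ y) z x → Twin (S ⊕ x ⊕ y) w u → D z x w u ≢ true
      near-far {S = S} {x} {y} {u} {v} {z} {w} L e z∈ w∈ tz tw a with twin-x⇒adj L e tz
      ... | tz′ , az = clash a (flip (swap (chainʳ
          (twin tw new₁ (old (v∈S e)) (≢-sym (∉⇒≢ (u∈S e) (x∉ L e))) (≢-sym (u≢v e)))
          (flipʳ (twin tw′ new₁ (old (v∈S e)) (≢-sym (∉⇒≢ (u∈S e) (x∉ L e′))) (≢-sym (u≢v e)))))))
        where
        e′ : Edge S z y u v
        e′ = mkEdge z∈ (y∈T e) (u∈S e) (v∈S e) (u≢v e) tz′ (ty e) az
        tw′ : Twin (S ⊕ z ⊕ y) w u
        tw′ = far L e′ w∈ (twin-⊆ old tw) (stay⇒¬adj L e (u∈S e) (u≢v e) tw)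

    -- Either `z` and `w` still share a twin, or they fall into the near and far parts of one block,
    -- which `near-far` excludes.
    no-edge-in-block : ∀ {k S x y u v z w t p q} → Level (suc (suc k)) S → Edge S x y u v →
      t ∈ S → Twin S z t → Twin S w t → ¬ Edge (S ⊕ x ⊕ y) z w p q
    no-edge-in-block {S = S} {x} {y} L e t∈ tz tw f = go (block L e (x∈T f) t∈ tz) (block L e (y∈T f) t∈ tw)
      where
      L₁ = edge⇒level L e
      isp : ∀ {p′} → p′ ∈ S ⊕ x ⊕ y → Twin (S ⊕ x ⊕ y) _ p′ → _ ≡ p′
      isp p′∈ t = unique L₁ (u∈S f) p′∈ (tx f) t
      isq : ∀ {q′} → q′ ∈ S ⊕ x ⊕ y → Twin (S ⊕ x ⊕ y) _ q′ → _ ≡ q′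
      isq q′∈ t = unique L₁ (v∈S f) q′∈ (ty f) t
      go : Block S x y _ _ _ _ → Block S x y _ _ _ _ → Empty.⊥
      go (stay t) (stay t′) = u≢v f (trans (isp (old t∈) t) (sym (isq (old t∈) t′)))
      go (at-x _ _ t) (at-x _ _ t′) = u≢v f (trans (isp new₁ t) (sym (isq new₁ t′)))
      go (at-y _ _ t) (at-y _ _ t′) = u≢v f (trans (isp ⊕-new t) (sym (isq ⊕-new t′)))
      go (at-x refl _ _) (at-y u≡v _ _) = u≢v e u≡v
      go (at-y refl _ _) (at-x v≡u _ _) = u≢v e (sym v≡u)
      go (at-x refl _ t) (stay t′) with refl ← isp new₁ t | refl ← isq (old t∈) t′ =
        near-far L e (x∈T f) (y∈T f) t t′ (adj f)
      go (stay t) (at-x refl _ t′) with refl ← isp (old t∈) t | refl ← isq new₁ t′ =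
        near-far L e (y∈T f) (x∈T f) t′ t (swap (adj f))
      go (at-y refl _ t) (stay t′) with refl ← isp ⊕-new t | refl ← isq (old t∈) t′ =
        near-far L (edge-sym e) (x∈T f) (y∈T f) (twin-comm t) (twin-comm t′) (adj f)
      go (stay t) (at-y refl _ t′) with refl ← isp (old t∈) t | refl ← isq ⊕-new t′ =
        near-far L (edge-sym e) (y∈T f) (x∈T f) (twin-comm t′) (twin-comm t) (swap (adj f))

    -- Carrying edges between consecutive levels.

    opaque
      -- Each end keeps its twin or has `x` in place of `u`. Going back from `x` to `u` changes `D`
      -- by a term that vanishes because the other end keeps its twin, and `no-edge-in-block` keeps
      -- the resulting twins distinct.
      descend : ∀ {k S x y u v z w p q} → Level (suc (suc k)) S → Edge S x y u v →
        Edge (S ⊕ x ⊕ y) z w p q → p ≢ y → q ≢ y → ∃₂ λ t s → Edge S z w t s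
      descend {S = S} {x} {y} {u} {v} {z} {w} {p} {q} L e f p≢y q≢y
        with π L (x∈T f) | π L (y∈T f)
      ... | t , t∈ , tz | s , s∈ , tw with block L e (x∈T f) t∈ tz | block L e (y∈T f) s∈ tw
      ...   | at-y _ _ tz₁    | _ = contradiction (unique (edge⇒level L e) (u∈S f) ⊕-new (tx f) tz₁) p≢y
      ...   | _               | at-y _ _ tw₁ = contradiction (unique (edge⇒level L e) (v∈S f) ⊕-new (ty f) tw₁) q≢y
      ...   | stay tz₁        | stay tw₁
        with refl ← unique (edge⇒level L e) (u∈S f) (old t∈) (tx f) tz₁
           | refl ← unique (edge⇒level L e) (v∈S f) (old s∈) (ty f) tw₁ =
        t , s , mkEdge (x∈T f) (y∈T f) t∈ s∈ (u≢v f) tz tw (adj f)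
      ...   | at-x _ _ tz₁    | at-x _ _ tw₁ = contradiction
        (trans (unique (edge⇒level L e) (u∈S f) new₁ (tx f) tz₁) (unique (edge⇒level L e) new₁ (v∈S f) tw₁ (ty f)))
        (u≢v f)
      ...   | at-x refl _ tz₁ | stay tw₁
        with refl ← unique (edge⇒level L e) (u∈S f) new₁ (tx f) tz₁
           | refl ← unique (edge⇒level L e) (v∈S f) (old s∈) (ty f) tw₁ =
        t , s , mkEdge (x∈T f) (y∈T f) t∈ s∈ t≢s tz tw
          (chain (adj f) (swap (twin tw₁ new₁ (old t∈) (≢-sym (∉⇒≢ s∈ (x∉ L e))) t≢s)))
        where
        t≢s : t ≢ s
        t≢s refl = no-edge-in-block L e t∈ tz tw f
      descend L e f p≢y q≢y | t , t∈ , tz | s , s∈ , tw | stay tz₁ | at-x refl _ tw₁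
        with refl ← unique (edge⇒level L e) (u∈S f) (old t∈) (tx f) tz₁
           | refl ← unique (edge⇒level L e) (v∈S f) new₁ (ty f) tw₁ =
        t , s , mkEdge (x∈T f) (y∈T f) t∈ s∈ t≢s tz tw
          (chainʳ (adj f) (twin tz₁ new₁ (old s∈) (≢-sym (∉⇒≢ t∈ (x∉ L e))) (≢-sym t≢s)))
        where
        t≢s : t ≢ s
        t≢s refl = no-edge-in-block L e t∈ tz tw f

    opaque
      -- At most one end can move to `x`, as the ends lie in different blocks; the other one stays,
      -- so `D` is unchanged.
      ascend : ∀ {k S x y u v z w t s} → Level (suc (suc k)) S → Edge S x y u v → Edge S z w t s →
        ¬ Twin (S ⊕ x ⊕ y) z y → ¬ Twin (S ⊕ x ⊕ y) w y → ∃₂ λ p q → Edge (S ⊕ x ⊕ y) z w p q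
      ascend {S = S} {x} {y} {u} {v} {z} {w} {t} {s} L e f ¬tz ¬tw
        with block L e (x∈T f) (u∈S f) (tx f) | block L e (y∈T f) (v∈S f) (ty f)
      ... | at-y _ _ tz₁    | _ = contradiction tz₁ ¬tz
      ... | _               | at-y _ _ tw₁ = contradiction tw₁ ¬tw
      ... | stay tz₁        | stay tw₁ =
        t , s , mkEdge (x∈T f) (y∈T f) (old (u∈S f)) (old (v∈S f)) (u≢v f) tz₁ tw₁ (adj f)
      ... | at-x t≡u _ _    | at-x s≡u _ _ = contradiction (trans t≡u (sym s≡u)) (u≢v f)
      ... | at-x refl _ tz₁ | stay tw₁ =
        x , s , mkEdge (x∈T f) (y∈T f) new₁ (old (v∈S f)) x≢s tz₁ tw₁
          (chain (adj f) (swap (twin tw₁ (old (u∈S f)) new₁ (u≢v f) x≢s)))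
        where
        x≢s : x ≢ s
        x≢s = ≢-sym (∉⇒≢ (v∈S f) (x∉ L e))
      ... | stay tz₁        | at-x refl _ tw₁ =
        t , x , mkEdge (x∈T f) (y∈T f) (old (u∈S f)) new₁ (≢-sym x≢t) tz₁ tw₁
          (chainʳ (adj f) (twin tz₁ (old (v∈S f)) new₁ (≢-sym (u≢v f)) x≢t))
        where
        x≢t : x ≢ t
        x≢t = ≢-sym (∉⇒≢ (u∈S f) (x∉ L e))

    -- Neighbourhoods, and edges that avoid a block.

    Neighbour : Subset m → Fin m → Fin m → Fin m → Set
    Neighbour S x u q = q ∈ T × ∃ λ s → s ∈ S × u ≢ s × Twin S q s × D x u q s ≡ true

    neighbour? : ∀ S x u → Decidable (Neighbour S x u)
    neighbour? S x u q = q ∈? T ×-dec any? λ s → s ∈? S ×-dec ¬? (u ≟ s) ×-dec twin? S q s ×-dec D x u q s ≟ᵇ true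

    -- Its size is the quantity that decreases in `avoiding-edge`.
    N : Subset m → Fin m → Fin m → Subset m
    N S x u = fromPred (neighbour? S x u)

    -- A neighbour `q` of `z` missed by `x` would stay in the block of `v` over `S ⊕ x ⊕ y′`, while
    -- `y` moves to that of `y′`; then `z` would have neighbours in two blocks. So the
    -- neighbourhoods are nested, and `y′` makes the inclusion strict.
    shrink : ∀ {k S x z y y′ u v} → Level (suc (suc (suc k))) S → Edge S x y u v → Edge S x y′ u v →
      Edge S z y u v → D z u y′ v ≡ false → ∣ N S z u ∣ < ∣ N S x u ∣
    shrink {S = S} {x} {z} {y} {y′} {u} {v} L e e′ f a = p⊂q⇒∣p∣<∣q∣
      ( (λ q∈ → ∈-fromPred⁺ (neighbour? S x u) (kept (∈-fromPred⁻ (neighbour? S z u) q∈)))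
      , y′
      , ∈-fromPred⁺ (neighbour? S x u) (y∈T e′ , v , v∈S e′ , u≢v e′ , ty e′ , adj e′)
      , λ y′∈ → lost (∈-fromPred⁻ (neighbour? S z u) y′∈))
      where
      L′ = edge⇒level L e′
      f′ : Edge (S ⊕ x ⊕ y′) z y u y′
      f′ = mkEdge (x∈T f) (y∈T f) (old (u∈S f)) ⊕-new (∉⇒≢ (u∈S f) (y∉ L e′))
        (far L e′ (x∈T f) (tx f) a) (nearʸ L e′ (y∈T e) (ty e) (swap (adj e)))
        (chainʳ (adj f) (flipʳ a))
      kept : ∀ {q} → Neighbour S z u q → Neighbour S x u q
      kept {q} (q∈ , s , s∈ , u≢s , tq , b)
        with refl ← same-block-of-neighbours L f (mkEdge (x∈T f) q∈ (u∈S f) s∈ u≢s (tx f) tq b)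
        with D x u q v in c
      ... | true  = q∈ , v , s∈ , u≢s , tq , c
      ... | false = contradiction
        (same-block-of-neighbours L′ f′ (mkEdge (x∈T f) q∈ (old (u∈S f)) (old s∈) u≢s (tx f′)
          (farʸ L e′ q∈ tq (swap c)) b))
        (∉⇒≢ s∈ (y∉ L e′))
      lost : ¬ Neighbour S z u y′
      lost (_ , s , s∈ , _ , t , b) with refl ← unique L s∈ (v∈S e′) t (ty e′) = clash b a

    -- Achieved by an x with fewest neighbours; it makes the edges over S ⊕ x ⊕ y edges over S (descend).
    Avoided : Subset m → Fin m → Fin m → Set
    Avoided S x y = ∀ {z w p q} → Edge (S ⊕ x ⊕ y) z w p q → p ≢ y × q ≢ y

    -- Being a twin of `y`, `w` is also a neighbour of `x`. Exactly one of `y` and `w` is a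
    -- neighbour of `z`: it is `y` if `z` is a twin of `x`, and `w` otherwise. This is the situation
    -- of `shrink`.
    smaller : ∀ {k S x y u v z w p} → Level (suc (suc (suc k))) S → Edge S x y u v →
      Edge (S ⊕ x ⊕ y) z w p y → ∃₂ λ y₁ v₁ → Edge S z y₁ u v₁ × ∣ N S z u ∣ < ∣ N S x u ∣
    smaller {S = S} {x} {y} {u} {v} {z} {w} {p} L e f with twin-y⇒adj L e (ty f) | π L (x∈T f)
    ... | tw , aw | t , t∈ , tz = by-block (block L e (x∈T f) t∈ tz)
      where
      L₁ = edge⇒level L e
      e′ : Edge S x w u v
      e′ = mkEdge (x∈T e) (y∈T f) (u∈S e) (v∈S e) (u≢v e) (tx e) tw (swap aw)
      by-block : Block S x y u v z t → ∃₂ λ y₁ v₁ → Edge S z y₁ u v₁ × ∣ N S z u ∣ < ∣ N S x u ∣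
      by-block (at-y _ _ tz₁) = contradiction (unique L₁ (u∈S f) ⊕-new (tx f) tz₁) (u≢v f)
      by-block (at-x refl zy tz₁) with refl ← unique L₁ (u∈S f) new₁ (tx f) tz₁ =
        y , v , f₁ , shrink L e e′ f₁ (chainʳ
          (chain (adj f) (swap (twin (ty f) new₁ (old (u∈S e)) (x≢y L e) (∉⇒≢ (u∈S e) (y∉ L e)))))
          zy)
        where
        f₁ : Edge S z y u v
        f₁ = mkEdge (x∈T f) (y∈T e) (u∈S e) (v∈S e) (u≢v e) tz (ty e) zy
      by-block (stay tz₁) with refl ← unique L₁ (u∈S f) (old t∈) (tx f) tz₁ = at (t ≟ v)
        where
        zy : t ≢ v → D z t y v ≡ false
        zy t≢v = stay⇒¬adj L e t∈ t≢v tz₁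
        at : Dec (t ≡ v) → ∃₂ λ y₁ v₁ → Edge S z y₁ u v₁ × ∣ N S z u ∣ < ∣ N S x u ∣
        at (yes refl) = Empty.⊥-elim (no-edge-in-block L e t∈ tz tw f)
        at (no t≢v)
          with f₁ ← mkEdge (x∈T f) (y∈T f) t∈ (v∈S e) t≢v tz tw (chainʳ (adj f) (zy t≢v))
          with refl ← same-block-of-neighbours L (edge-sym e′) (edge-sym f₁) =
          w , v , f₁ , shrink L e′ e f₁ (zy t≢v)

    opaque
      -- Descent on the number of neighbours of `x`: as long as some edge over `S ⊕ x ⊕ y` has an
      -- end with twin `y`, `smaller` supplies a better `x`.
      avoiding-edge : ∀ {k S} → Level (suc (suc (suc k))) S →
        ∃₂ λ x y → ∃₂ λ u v → Edge S x y u v × Avoided S x y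
      avoiding-edge {S = S} L with some-edge L
      ... | x , y , u , v , e = search ∣ N S x u ∣ e ≤-refl
        where
        search : ∀ n {x y u v} → Edge S x y u v → ∣ N S x u ∣ ≤ n →
          ∃₂ λ x y → ∃₂ λ u v → Edge S x y u v × Avoided S x y
        search n {x} {y} {u} {v} e bound
          with any? (λ z → any? λ w → any? λ p → z ∈? T ×-dec w ∈? T ×-dec p ∈? (S ⊕ x ⊕ y) ×-dec ¬? (p ≟ y)
            ×-dec twin? (S ⊕ x ⊕ y) z p ×-dec twin? (S ⊕ x ⊕ y) w y ×-dec D z p w y ≟ᵇ true)
        ... | no none = x , y , u , v , e , λ f →
          (λ { refl → none (_ , _ , _ , y∈T f , x∈T f , v∈S f , ≢-sym (u≢v f) , ty f , tx f , swap (adj f)) }) ,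
          (λ { refl → none (_ , _ , _ , x∈T f , y∈T f , u∈S f , u≢v f , tx f , ty f , adj f) })
        ... | yes (z , w , p , z∈ , w∈ , p∈ , p≢y , tz , tw , a)
          with smaller L e (mkEdge z∈ w∈ p∈ ⊕-new p≢y tz tw a)
        ...   | y₁ , v₁ , e₁ , lt = recurse n (≤-trans lt bound)
          where
          recurse : ∀ n → ∣ N S z u ∣ < n → ∃₂ λ x y → ∃₂ λ u v → Edge S x y u v × Avoided S x y
          recurse (suc n) (s≤s le) = search n e₁ le

    opaque
      -- Here a single edge over `S ⊕ x ⊕ y` has to avoid `y`, and this can be had one level lower
      -- than `avoiding-edge`.
      avoiding-pair : ∀ {k S} → Level (suc (suc k)) S → ∃₂ λ x y → ∃₂ λ u v → ∃₂ λ z w → ∃₂ λ p q →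
        Edge S x y u v × Edge (S ⊕ x ⊕ y) z w p q × p ≢ y × q ≢ y
      avoiding-pair {k} {S} L with some-edge L
      ... | x , y , u , v , e with some-edge (edge⇒level L e)
      ... | z , w , p , q , f = choose (p ≟ x) (p ≟ y) (q ≟ x) (q ≟ y)
        where
        Goal : Set
        Goal = ∃₂ λ x y → ∃₂ λ u v → ∃₂ λ z w → ∃₂ λ p q →
          Edge S x y u v × Edge (S ⊕ x ⊕ y) z w p q × p ≢ y × q ≢ y

        -- Here z – y – x – w is an induced path, and its outer edges are taken instead.
        rematch : ∀ {z w} → Edge (S ⊕ x ⊕ y) z w x y → Goal
        rematch {z} {w} f with twin-x⇒adj L e (tx f) | twin-y⇒adj L e (ty f)
        ... | tz , az | tw , aw = z , y , u , v , x , w , z , v , e′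
            , mkEdge (x∈T e) (y∈T f) new₁ (old (v∈S e)) z≢v
                (near L e′ (x∈T e) (tx e) (adj e))
                (farʸ L e′ (y∈T f) tw (swap zw))
                (chain (swap aw) (flip zw))
            , x≢y L e′ , ∉⇒≢ (v∈S e) (y∉ L e)
          where
          e′ : Edge S z y u v
          e′ = mkEdge (x∈T f) (y∈T e) (u∈S e) (v∈S e) (u≢v e) tz (ty e) az
          z≢v : z ≢ v
          z≢v = ≢-sym (∉⇒≢ (v∈S e) (x∉ L e′))
          zw : D z u w v ≡ false
          zw = chainʳ
            (chain (adj f) (swap (twin (ty f) new₁ (old (u∈S e)) (x≢y L e) (∉⇒≢ (u∈S e) (y∉ L e)))))
            az

        choose : Dec (p ≡ x) → Dec (p ≡ y) → Dec (q ≡ x) → Dec (q ≡ y) → Goal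
        choose _ (no p≢y) _ (no q≢y) = x , y , u , v , z , w , p , q , e , f , p≢y , q≢y
        choose (no p≢x) _ (no q≢x) _ = y , x , v , u , z , w , p , q , edge-sym e
          , subst (λ R → Edge R z w p q) (⊕-comm S x y) f , p≢x , q≢x
        choose (yes refl) (yes x≡y) _ _ = contradiction x≡y (x≢y L e)
        choose _ _ (yes refl) (yes x≡y) = contradiction x≡y (x≢y L e)
        choose (yes refl) (no _) _ (yes refl) = rematch f
        choose (no _) (yes refl) (yes refl) (no _) = rematch (edge-sym f)

    -- Three pairs with twins in cyclic position.

    -- The three `a` share one block over `S`, the three `b` another. The twin of `b₃` is `v₁` over
    -- the extension by the first pair but `b₂` over that by the second, and no twin over the
    -- extension by both is compatible with this.
    no-cycle : ∀ {k S a₁ b₁ a₂ b₂ a₃ b₃ u₁ v₁ u₂ v₂ u₃ v₃ p q} → Level (suc (suc k)) S →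
      Edge S a₁ b₁ u₁ v₁ → Edge S a₂ b₂ u₂ v₂ → Edge S a₃ b₃ u₃ v₃ →
      Edge (S ⊕ a₁ ⊕ b₁) a₃ b₃ p q → ∀ {l} → Level (suc l) (S ⊕ a₁ ⊕ b₁ ⊕ a₂ ⊕ b₂) →
      Twin (S ⊕ a₁ ⊕ b₁) a₃ a₁ → Twin (S ⊕ a₂ ⊕ b₂) a₁ a₂ → ¬ Twin (S ⊕ a₃ ⊕ b₃) a₂ a₃
    no-cycle {S = S} {a₁} {b₁} {a₂} {b₂} {a₃} {b₃} {u₁} {v₁} L e₁ e₂ e₃ f L₁₂ t₃ t₁ t₂
      with twin-x⇒adj L e₁ t₃ | twin-x⇒adj L e₂ t₁ | twin-x⇒adj L e₃ t₂
    ... | s₃ , a₃₁ | s₁ , a₁₂ | s₂ , a₂₃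
      with refl ← unique L (u∈S e₁) (u∈S e₃) s₃ (tx e₃)
         | refl ← unique L (u∈S e₂) (u∈S e₁) s₁ (tx e₁)
      with refl ← same-block-of-neighbours L e₁ (mkEdge (x∈T e₁) (y∈T e₂) (u∈S e₁) (v∈S e₂) (u≢v e₂) (tx e₁) (ty e₂) a₁₂)
         | refl ← same-block-of-neighbours L (mkEdge (x∈T e₃) (y∈T e₁) (u∈S e₁) (v∈S e₁) (u≢v e₁) (tx e₃) (ty e₁) a₃₁) e₃ =
      end (π L₁₂ (y∈T e₃))
      where
      L₁ = edge⇒level L e₁
      L₂ = edge⇒level L e₂

      b₂~b₁ : Twin (S ⊕ a₁ ⊕ b₁) b₂ b₁
      b₂~b₁ = nearʸ L e₁ (y∈T e₂) (ty e₂) (swap a₁₂)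

      b₃~b₂ : Twin (S ⊕ a₂ ⊕ b₂) b₃ b₂
      b₃~b₂ = nearʸ L e₂ (y∈T e₃) (ty e₃) (swap a₂₃)

      b₃~v : Twin (S ⊕ a₁ ⊕ b₁) b₃ v₁
      b₃~v with D b₃ v₁ a₁ u₁ in c
      ... | false = farʸ L e₁ (y∈T e₃) (ty e₃) c
      -- Otherwise `a₁` and `a₃` are both adjacent to `b₁` and `b₃`, so `D a₃ a₁ b₃ b₁` vanishes,
      -- against `f`.
      ... | true
        with refl ← unique L₁ (u∈S f) new₁ (tx f) t₃
           | refl ← unique L₁ (v∈S f) ⊕-new (ty f) (nearʸ L e₁ (y∈T e₃) (ty e₃) c) =
        clash (adj f) (chain (chainʳ (adj e₃) (flipʳ a₃₁)) (flip (chainʳ (swap c) (flipʳ (adj e₁)))))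

      b₂≢old : ∀ {t} → t ∈ S ⊕ a₁ ⊕ b₁ → Twin (S ⊕ a₁ ⊕ b₁) b₃ t → t ≢ b₂
      b₂≢old t∈ tt refl = y∉ L e₂ (subst (_∈ S) (unique L₁ (old (v∈S e₁)) t∈ b₃~v tt) (v∈S e₁))

      end : (∃ λ t → t ∈ S ⊕ a₁ ⊕ b₁ ⊕ a₂ ⊕ b₂ × Twin (S ⊕ a₁ ⊕ b₁ ⊕ a₂ ⊕ b₂) b₃ t) → Empty.⊥
      end (t , t∈ , tt) with ⊕⊕⁻ t∈
      ... | inj₁ t∈₁ with refl ← unique L₁ (old (v∈S e₁)) t∈₁ b₃~v (twin-⊆ old tt) =
        ∉⇒≢ (v∈S e₁) (y∉ L e₂)
          (unique L₂ (old (v∈S e₁)) ⊕-new (twin-⊆ (⊕⊕-mono old) tt) b₃~b₂)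
      ... | inj₂ (inj₁ refl) = x≢y L e₂ (unique L₂ new₁ ⊕-new (twin-⊆ (⊕⊕-mono old) tt) b₃~b₂)
      ... | inj₂ (inj₂ refl) with b₂ ∈? (S ⊕ a₁ ⊕ b₁)
      ...   | yes b₂∈ = b₂≢old b₂∈ (twin-⊆ old tt) refl
      -- Through `b₃`, `b₂` becomes a twin of `v₁` over the first extension, where its twin is
      -- already `b₁`.
      ...   | no b₂∉  = ∉⇒≢ (v∈S e₁) (y∉ L e₁)
        (unique L₁ (old (v∈S e₁)) ⊕-new (twin-join old b₂∉ tt b₃~v) b₂~b₁)

    -- A twin found in a pair may be either end; this puts it first.
    orient : ∀ {x y t} → t ≡ x ⊎ t ≡ y → ∃ λ b →
      (∀ R → R ⊕ x ⊕ y ≡ R ⊕ t ⊕ b) × (∀ {R u v} → Edge R x y u v → ∃₂ λ u v → Edge R t b u v)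
    orient {y = y} (inj₁ refl) = y , (λ _ → refl) , λ e → _ , _ , e
    orient {x = x} (inj₂ refl) = x , (λ R → ⊕-comm R _ _) , λ e → _ , _ , edge-sym e

    module _ {k S x₁ y₁ x₂ y₂ x₃ y₃ u₁ v₁ u₂ v₂ u₃ v₃ p q} (L : Level (suc (suc k)) S)
      (e₁ : Edge S x₁ y₁ u₁ v₁) (e₂ : Edge S x₂ y₂ u₂ v₂) (e₃ : Edge S x₃ y₃ u₃ v₃)
      (f : Edge (S ⊕ x₁ ⊕ y₁) x₃ y₃ p q) {l} (L₁₂ : Level (suc l) (S ⊕ x₁ ⊕ y₁ ⊕ x₂ ⊕ y₂)) where

      private
        S₁ = S ⊕ x₁ ⊕ y₁
        S₂ = S ⊕ x₂ ⊕ y₂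
        S₃ = S ⊕ x₃ ⊕ y₃
        L₁ = edge⇒level L e₁
        L₂ = edge⇒level L e₂
        L₃ = edge⇒level L e₃

      -- Uniqueness over `S₁`, `S₃` and `S₂` in turn puts `t₂` in the third pair, `t₁` in the second
      -- and `t₃` in the first. As twins of `w` they are twins of one another over the single
      -- extensions, in the cyclic pattern excluded by `no-cycle`.
      cyclic : ∀ {w t₁ t₂ t₃} →
        Twin (S₁ ⊕ x₂ ⊕ y₂) w t₃ → Twin (S₁ ⊕ x₃ ⊕ y₃) w t₂ → Twin (S₂ ⊕ x₃ ⊕ y₃) w t₁ →
        t₂ ∈ S₁ ⊕ x₃ ⊕ y₃ → t₁ ∈ S₂ ⊕ x₃ ⊕ y₃ → t₁ ≢ t₂ → t₁ ≢ t₃ → t₂ ≢ t₃ → t₃ ∉ S₁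
      cyclic {w} {t₁} {t₂} {t₃} w~t₃ w~t₂ w~t₁ t₂∈ t₁∈ t₁≢t₂ t₁≢t₃ t₂≢t₃ t₃∈S₁ = end
        where
        t₂∉S₁ : t₂ ∉ S₁
        t₂∉S₁ t₂∈S₁ = t₂≢t₃ (unique L₁ t₂∈S₁ t₃∈S₁ (twin-⊆ old w~t₂) (twin-⊆ old w~t₃))

        t₂-new : t₂ ≡ x₃ ⊎ t₂ ≡ y₃
        t₂-new = [ (λ t₂∈S₁ → contradiction t₂∈S₁ t₂∉S₁) , id ]′ (⊕⊕⁻ t₂∈)

        t₁∉S₃ : t₁ ∉ S₃
        t₁∉S₃ t₁∈S₃ = t₁≢t₂ (unique L₃ t₁∈S₃ ([ (λ { refl → new₁ }) , (λ { refl → ⊕-new }) ]′ t₂-new)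
          (twin-⊆ (⊕⊕-mono old) w~t₁) (twin-⊆ (⊕⊕-mono old) w~t₂))

        t₁∈S₂ : t₁ ∈ S₂
        t₁∈S₂ with ⊕⊕⁻ t₁∈
        ... | inj₁ t₁∈S₂       = t₁∈S₂
        ... | inj₂ (inj₁ refl) = contradiction new₁ t₁∉S₃
        ... | inj₂ (inj₂ refl) = contradiction ⊕-new t₁∉S₃

        t₁-new : t₁ ≡ x₂ ⊎ t₁ ≡ y₂
        t₁-new = [ (λ t₁∈S → contradiction (old t₁∈S) t₁∉S₃) , id ]′ (⊕⊕⁻ t₁∈S₂)

        t₃∉S₂ : t₃ ∉ S₂
        t₃∉S₂ t₃∈S₂ = t₁≢t₃ (unique L₂ t₁∈S₂ t₃∈S₂ (twin-⊆ old w~t₁) (twin-⊆ (⊕⊕-mono old) w~t₃))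

        t₃-new : t₃ ≡ x₁ ⊎ t₃ ≡ y₁
        t₃-new = [ (λ t₃∈S → contradiction (old t₃∈S) t₃∉S₂) , id ]′ (⊕⊕⁻ t₃∈S₁)

        end : Empty.⊥
        end with orient t₃-new | orient t₁-new | orient t₂-new
        ... | b₁ , eq₁ , or₁ | b₂ , eq₂ , or₂ | b₃ , eq₃ , or₃ with or₃ f
        ... | p′ , q′ , f′ =
          no-cycle L (proj₂ (proj₂ (or₁ e₁))) (proj₂ (proj₂ (or₂ e₂))) (proj₂ (proj₂ (or₃ e₃)))
            (subst (λ R → Edge R t₂ b₃ p′ q′) (eq₁ S) f′)
            (subst (Level (suc l)) (trans (eq₂ S₁) (cong (λ R → R ⊕ t₁ ⊕ b₂) (eq₁ S))) L₁₂)
            (subst (λ R → Twin R t₂ t₃) (eq₁ S) (twin-join old t₂∉S₁ w~t₂ (twin-⊆ old w~t₃)))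
            (subst (λ R → Twin R t₃ t₁) (eq₂ S) (twin-join (⊕⊕-mono old) t₃∉S₂ w~t₃ (twin-⊆ old w~t₁)))
            (subst (λ R → Twin R t₁ t₂) (eq₃ S) (twin-join (⊕⊕-mono old) t₁∉S₃ w~t₁ (twin-⊆ (⊕⊕-mono old) w~t₂)))

    -- Excluding codimension 7 and all larger odd codimensions.

    -- As `A` and `B` reach everything but `w`, `t` would be a twin of `w` in the prime set `T`; an
    -- element of `X` is the reference common to both.
    no-common-twin : ∀ {k l A B w t} → Level k A → Level l B → w ∈ T → w ∉ A →
      (∀ {c} → c ∈ T → c ≢ w → c ∈ A ⊎ c ∈ B) → t ∈ A → Twin A w t → ¬ Twin B w t
    no-common-twin {w = w} {t} LA LB w∈ w∉A cover t∈A ta tb with bigX t t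
    ... | e , _ , e∈ , _ , _ , (e≢t , _) , _ =
      twins⇒¬prime (big-⊆ (sub LA ∘ base LA) bigX) w∈ (sub LA t∈A) (≢-sym (∉⇒≢ t∈A w∉A))
        (λ c∈ d∈ c≢w c≢t d≢w d≢t → chainʳ (to-e c∈ c≢w c≢t) (flipʳ (to-e d∈ d≢w d≢t))) primeT
      where
      to-e : ∀ {c} → c ∈ T → c ≢ w → c ≢ t → D w t c e ≡ false
      to-e c∈ c≢w c≢t with cover c∈ c≢w
      ... | inj₁ c∈A = twin ta c∈A (base LA e∈) c≢t e≢t
      ... | inj₂ c∈B = twin tb c∈B (base LB e∈) c≢t e≢t

    -- Edges named `e`, `g`, `k`, `h` are over `S`, `S₁`, `S₂`, `S₁₂`. The second and third pairs
    -- are found above the first and brought down by `descend`; only `k₃` is then raised by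
    -- `ascend`.
    codim≢7 : ∀ {S} → ¬ Level 3 S
    codim≢7 {S} L with avoiding-edge L
    ... | x₁ , y₁ , _ , _ , e₁ , avoid with avoiding-pair (edge⇒level L e₁)
    ... | x₂ , y₂ , _ , _ , x₃ , y₃ , _ , _ , g₂ , h₃ , p≢y₂ , q≢y₂
      with descend (edge⇒level L e₁) g₂ h₃ p≢y₂ q≢y₂
    ... | _ , _ , g₃ with descend L e₁ g₂ (proj₁ (avoid g₂)) (proj₂ (avoid g₂))
                        | descend L e₁ g₃ (proj₁ (avoid g₃)) (proj₂ (avoid g₃))
    ... | _ , _ , e₂ | _ , _ , e₃ = with-k₃ (ascend L e₂ e₃
            (not-y₂ (u∈S h₃) (tx h₃) p≢y₂ (λ t → proj₁ (avoid g₃) (unique L₁ (u∈S g₃) ⊕-new (tx g₃) t)))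
            (not-y₂ (v∈S h₃) (ty h₃) q≢y₂ (λ t → proj₂ (avoid g₃) (unique L₁ (v∈S g₃) ⊕-new (ty g₃) t))))
      where
      S₁   = S ⊕ x₁ ⊕ y₁
      S₂   = S ⊕ x₂ ⊕ y₂
      S₁₂  = S₁ ⊕ x₂ ⊕ y₂
      S₁₃  = S₁ ⊕ x₃ ⊕ y₃
      S₂₃  = S₂ ⊕ x₃ ⊕ y₃
      S₁₂₃ = S₁₂ ⊕ x₃ ⊕ y₃
      L₁   = edge⇒level L e₁
      L₂   = edge⇒level L e₂
      L₁₂  = edge⇒level L₁ g₂
      L₁₃  = edge⇒level L₁ g₃
      L₁₂₃ = edge⇒level L₁₂ h₃

      x₁∉S₂ : x₁ ∉ S₂
      x₁∉S₂ x₁∈ with ⊕⊕⁻ x₁∈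
      ... | inj₁ x₁∈S        = x∉ L e₁ x₁∈S
      ... | inj₂ (inj₁ refl) = x∉ L₁ g₂ new₁
      ... | inj₂ (inj₂ refl) = y∉ L₁ g₂ new₁

      -- Otherwise `x₁` and `x₂` form an edge, which makes `x₂` a twin of `y₁` over `S₁`, against
      -- `avoid`.
      x₁≁y₂ : ¬ Twin S₂ x₁ y₂
      x₁≁y₂ t with twin-y⇒adj L e₂ t
      ... | t′ , a with refl ← unique L (u∈S e₁) (v∈S e₂) (tx e₁) t′
        with refl ← same-block-of-neighbours L e₁
               (mkEdge (x∈T e₁) (x∈T e₂) (u∈S e₁) (u∈S e₂) (≢-sym (u≢v e₂)) (tx e₁) (tx e₂) a) =
        proj₁ (avoid g₂) (unique L₁ (u∈S g₂) ⊕-new (tx g₂) (nearʸ L e₁ (x∈T e₂) (tx e₂) (swap a)))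

      -- Uniqueness over `S₂` leaves only `x₁` and `y₁` for `p`; these fall to `x₁≁y₂` and to the
      -- hypothesis on `y₁`.
      not-y₂ : ∀ {z p} → p ∈ S₁₂ → Twin S₁₂ z p → p ≢ y₂ → ¬ Twin S₁ z y₁ → ¬ Twin S₂ z y₂
      not-y₂ p∈ tz p≢y₂ ¬t t with ⊕⊕⁻ p∈
      ... | inj₂ (inj₁ refl) = p≢y₂ (unique L₂ new₁ ⊕-new (twin-⊆ (⊕⊕-mono old) tz) t)
      ... | inj₂ (inj₂ refl) = p≢y₂ refl
      ... | inj₁ p∈₁ with ⊕⊕⁻ p∈₁
      ...   | inj₁ p∈S         = p≢y₂ (unique L₂ (old p∈S) ⊕-new (twin-⊆ (⊕⊕-mono old) tz) t)
      ...   | inj₂ (inj₁ refl) = x₁≁y₂ (twin-join (⊕⊕-mono old) x₁∉S₂ tz t)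
      ...   | inj₂ (inj₂ refl) = ¬t (twin-⊆ old tz)

      with-k₃ : (∃₂ λ p q → Edge S₂ x₃ y₃ p q) → Empty.⊥
      -- From codimension 7, three pairs leave exactly one element `w`.
      with-k₃ (_ , _ , k₃) with fresh {S = S₁₂₃} {T} (≤-reflexive (sym (codim L₁₂₃)))
      ... | w , w∈ , w∉ with π L₁₂ w∈ | π L₁₃ w∈ | π (edge⇒level L₂ k₃) w∈
      ... | t₃ , t₃∈ , w~t₃ | t₂ , t₂∈ , w~t₂ | t₁ , t₁∈ , w~t₁ = by-t₃ (⊕⊕⁻ t₃∈)
        where
        L₂₃ = edge⇒level L₂ k₃

        last : ∀ {c} → c ∈ T → c ≢ w → c ∈ S₁₂₃
        last {c} c∈ c≢w = decidable-stable (c ∈? S₁₂₃) λ c∉ →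
          <-irrefl (sym (codim L₁₂₃)) (subst (_≤ ∣ T ∣) (∣⊕⊕∣ c∉ w∉ c≢w)
            (p⊆q⇒∣p∣≤∣q∣ (⊕⊕⊆T (sub L₁₂₃) c∈ w∈)))

        t₂≢t₃ : t₂ ≢ t₃
        t₂≢t₃ refl = no-common-twin L₁₂ L₁₃ w∈ (w∉ ∘ old) cover t₃∈ w~t₃ w~t₂
          where
          cover : ∀ {c} → c ∈ T → c ≢ w → c ∈ S₁₂ ⊎ c ∈ S₁₃
          cover c∈ c≢w with ⊕⊕⁻ (last c∈ c≢w)
          ... | inj₁ c∈₁₂        = inj₁ c∈₁₂
          ... | inj₂ (inj₁ refl) = inj₂ new₁
          ... | inj₂ (inj₂ refl) = inj₂ ⊕-new

        t₁≢t₃ : t₁ ≢ t₃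
        t₁≢t₃ refl = no-common-twin L₁₂ L₂₃ w∈ (w∉ ∘ old) cover t₃∈ w~t₃ w~t₁
          where
          cover : ∀ {c} → c ∈ T → c ≢ w → c ∈ S₁₂ ⊎ c ∈ S₂₃
          cover c∈ c≢w with ⊕⊕⁻ (last c∈ c≢w)
          ... | inj₁ c∈₁₂        = inj₁ c∈₁₂
          ... | inj₂ (inj₁ refl) = inj₂ new₁
          ... | inj₂ (inj₂ refl) = inj₂ ⊕-new

        t₁≢t₂ : t₁ ≢ t₂
        t₁≢t₂ refl = no-common-twin L₁₃ L₂₃ w∈ (w∉ ∘ ⊕⊕-mono old) cover t₂∈ w~t₂ w~t₁
          where
          cover : ∀ {c} → c ∈ T → c ≢ w → c ∈ S₁₃ ⊎ c ∈ S₂₃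
          cover c∈ c≢w with ⊕⊕⁻ (last c∈ c≢w)
          ... | inj₂ (inj₁ refl) = inj₂ new₁
          ... | inj₂ (inj₂ refl) = inj₂ ⊕-new
          ... | inj₁ c∈₁₂ with ⊕⊕⁻ c∈₁₂
          ...   | inj₁ c∈₁         = inj₁ (old c∈₁)
          ...   | inj₂ (inj₁ refl) = inj₂ (old new₁)
          ...   | inj₂ (inj₂ refl) = inj₂ (old ⊕-new)

        -- The first two pairs exchange roles, which covers `t₃` in the second pair.
        swapped : t₃ ∉ S₂
        swapped = cyclic L e₂ e₁ e₃ k₃ (subst (Level 1) S₁₂≡ L₁₂) (subst (λ R → Twin R w t₃) S₁₂≡ w~t₃)
          w~t₁ w~t₂ t₁∈ t₂∈ (≢-sym t₁≢t₂) t₂≢t₃ t₁≢t₃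
          where
          S₁₂≡ : S₁₂ ≡ S₂ ⊕ x₁ ⊕ y₁
          S₁₂≡ = ⊕⊕-comm S x₁ y₁ x₂ y₂

        by-t₃ : t₃ ∈ S₁ ⊎ t₃ ≡ x₂ ⊎ t₃ ≡ y₂ → Empty.⊥
        by-t₃ (inj₁ t₃∈S₁)       = cyclic L e₁ e₂ e₃ g₃ L₁₂ w~t₃ w~t₂ w~t₁ t₂∈ t₁∈ t₁≢t₂ t₁≢t₃ t₂≢t₃ t₃∈S₁
        by-t₃ (inj₂ (inj₁ refl)) = swapped new₁
        by-t₃ (inj₂ (inj₂ refl)) = swapped ⊕-new

    codim≱7 : ∀ k {S} → ¬ Level (3 + k) S
    codim≱7 zero    L = codim≢7 L
    codim≱7 (suc k) L with some-edge L
    ... | _ , _ , _ , _ , e = codim≱7 k (edge⇒level L e)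

-- Translation between graphs and splits.

-- Index `zero` is the isolated vertex ∞ and a vertex `x` becomes `suc x`, so `true ∷ X` is `X` with
-- ∞ added.
adjacency : ∀ {n} → Graph n → Fin (suc n) → Fin (suc n) → Bool
adjacency G zero    _       = false
adjacency G (suc x) zero    = false
adjacency G (suc x) (suc y) = does (adj? G x y)

adjacency-sym : ∀ {n} (G : Graph n) x y → adjacency G x y ≡ adjacency G y x
adjacency-sym G zero    zero    = refl
adjacency-sym G zero    (suc y) = refl
adjacency-sym G (suc x) zero    = refl
adjacency-sym G (suc x) (suc y) = does-⇔ (mk⇔ (adj-sym G) (adj-sym G)) (adj? G x y) (adj? G y x)

does≡⇒ : ∀ {A B : Set} (a? : Dec A) (b? : Dec B) → does a? ≡ does b? → A → B
does≡⇒ (yes _) (yes b) _  _ = b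
does≡⇒ (no ¬a) _       _  a = contradiction a ¬a

module _ {n : ℕ} (G : Graph n) where

  open Splits (adjacency G) (adjacency-sym G)

  private
    ∞ : Fin (suc n)
    ∞ = zero

    lone : ∀ x → adjacency G x ∞ ≡ false
    lone zero    = refl
    lone (suc x) = refl

  finite-of-many : ∀ {X : Subset n} {B} → Many (true ∷ X) B → ∃ λ c → c ∈ X × B (suc c)
  finite-of-many (zero  , zero  , _ , _ , a≢b , _)            = contradiction refl a≢b
  finite-of-many (suc c , _     , there c∈ , _ , _ , Bc , _)  = c , c∈ , Bc
  finite-of-many (zero  , suc c , _ , there c∈ , _ , _ , Bc)  = c , c∈ , Bc

  finite-part? : ∀ X {A : Fin (suc n) → Set} → Decidable A → Decidable (λ x → x ∈ X × A (suc x))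
  finite-part? X {A} A? x = x ∈? X ×-dec A? (suc x)

  -- The side without ∞ is a nontrivial interval: ∞ is adjacent to nothing, so as fourth argument of
  -- `D` it turns the split condition into equality of adjacencies.
  finite-split⇒decomposable : ∀ {X A} → Decidable A → Split (true ∷ X) A → ¬ A ∞ → Many (true ∷ X) A →
    (∃ λ c → c ∈ X × ¬ A (suc c)) → ¬ Indecomposable (G [ X ])
  finite-split⇒decomposable _ _ ¬A∞ (zero , _ , _ , _ , _ , A∞ , _) _ _ = ¬A∞ A∞
  finite-split⇒decomposable _ _ ¬A∞ (suc _ , zero , _ , _ , _ , _ , A∞) _ _ = ¬A∞ A∞
  finite-split⇒decomposable {X} {A} A? sp ¬A∞ (suc a , suc b , there a∈ , there b∈ , a≢b , Aa , Ab) (c , c∈ , ¬Ac) ind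
    with ind I (I⊆X , interval)
    where
    I? : Decidable (λ x → x ∈ X × A (suc x))
    I? = finite-part? X {A} A?
    I : Subset n
    I = fromPred I?
    I⊆X : I ⊆ X
    I⊆X x∈ = proj₁ (∈-fromPred⁻ I? x∈)
    transfer : ∀ {x y z} → x ∈ X → x ∉ I → y ∈ X → A (suc y) → z ∈ X → A (suc z) → Adj G x y → Adj G x z
    transfer {x} {y} {z} x∈ x∉ y∈ Ay z∈ Az e = adj-sym G (does≡⇒ (adj? G y x) (adj? G z x)
      (rows-agree⁻ (trans (lone (suc y)) (sym (lone (suc z))))
        (sp (there y∈) (there z∈) (there x∈) here Ay Az (λ Ax → x∉ (∈-fromPred⁺ I? (x∈ , Ax))) ¬A∞))
      (adj-sym G e))
    interval : ∀ x → x ∈ X → x ∉ I →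
      (∀ y → y ∈ I → Adj (G [ X ]) x y) ⊎ (∀ y → y ∈ I → ¬ Adj (G [ X ]) x y)
    interval x x∈ x∉ with adj? G x a
    ... | yes e = inj₁ λ y y∈ → let (y∈X , Ay) = ∈-fromPred⁻ I? y∈ in
      x∈ , y∈X , transfer x∈ x∉ a∈ Aa y∈X Ay e
    ... | no ¬e = inj₂ λ y y∈ (_ , _ , e) → let (y∈X , Ay) = ∈-fromPred⁻ I? y∈ in
      ¬e (transfer x∈ x∉ y∈X Ay a∈ Aa e)
  ... | inj₁ I≡⊥ = ∉⊥ (subst (a ∈_) I≡⊥ (∈-fromPred⁺ (finite-part? X {A} A?) (a∈ , Aa)))
  ... | inj₂ (inj₁ I≡X) = ¬Ac (proj₂ (∈-fromPred⁻ (finite-part? X {A} A?) (subst (c ∈_) (sym I≡X) c∈)))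
  ... | inj₂ (inj₂ (x , _ , I≡x)) = a≢b (cong suc (trans (is-x a∈ Aa) (sym (is-x b∈ Ab))))
    where
    is-x : ∀ {y} → y ∈ X → A (suc y) → y ≡ x
    is-x {y} y∈ Ay = x∈⁅y⁆⇒x≡y x (subst (y ∈_) I≡x (∈-fromPred⁺ (finite-part? X {A} A?) (y∈ , Ay)))

  indecomposable⇒prime : ∀ {X} → Indecomposable (G [ X ]) → Prime (true ∷ X)
  indecomposable⇒prime {X} ind A A? sp manyA many¬A with A? ∞
  ... | no ¬A∞ = finite-split⇒decomposable A? sp ¬A∞ manyA (finite-of-many many¬A) ind
  -- Here ∞ lies in `A`, so the complement provides the interval.
  ... | yes A∞ with finite-of-many manyA
  ...   | c , c∈ , Ac = finite-split⇒decomposable (¬? ∘ A?)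
    (λ a∈ b∈ c∈ d∈ ¬a ¬b c d →
      swap (sp c∈ d∈ a∈ b∈ (decidable-stable (A? _) c) (decidable-stable (A? _) d) ¬a ¬b))
    (λ ¬A∞ → ¬A∞ A∞) many¬A (c , c∈ , λ ¬Ac → ¬Ac Ac) ind

  prime⇒indecomposable : ∀ {X} → Prime (true ∷ X) → Indecomposable (G [ X ])
  prime⇒indecomposable {X} pr I (I⊆X , interval) with any? (_∈? I)
  ... | no none = inj₁ (⊆-antisym (λ x∈ → contradiction (_ , x∈) none) (λ x∈ → contradiction x∈ ∉⊥))
  ... | yes (a , a∈) with any? (λ b → b ∈? I ×-dec ¬? (a ≟ b))
  ...   | no none = inj₂ (inj₂ (a , I⊆X a∈ , ⊆-antisym
            (λ {x} x∈ → subst (_∈ ⁅ a ⁆) (decidable-stable (a ≟ x) λ a≢x → none (x , x∈ , a≢x)) (x∈⁅x⁆ a))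
            (λ x∈ → subst (_∈ I) (sym (x∈⁅y⁆⇒x≡y a x∈)) a∈)))
  ...   | yes (b , b∈ , a≢b) with any? (λ c → c ∈? X ×-dec ¬? (c ∈? I))
  ...     | no none = inj₂ (inj₁ (⊆-antisym I⊆X λ {x} x∈ → decidable-stable (x ∈? I) λ x∉ → none (x , x∈ , x∉)))
  -- Besides `c`, the side opposite the interval contains ∞, hence two elements.
  ...     | yes (c , c∈ , c∉) = Empty.⊥-elim (pr A A? split
            (suc a , suc b , there (I⊆X a∈) , there (I⊆X b∈) , (λ { refl → a≢b refl }) , a∈ , b∈)
            (suc c , zero , there c∈ , here , (λ ()) , c∉ , λ ()))
    where
    A : Fin (suc n) → Set
    A zero    = Empty.⊥
    A (suc x) = x ∈ I
    A? : Decidable A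
    A? zero    = no λ ()
    A? (suc x) = x ∈? I
    agree : ∀ {x y z} → x ∈ I → y ∈ I → z ∈ true ∷ X → ¬ A z → adjacency G (suc x) z ≡ adjacency G (suc y) z
    agree {z = zero} _ _ _ _ = refl
    agree {x} {y} {suc z} x∈ y∈ (there z∈) z∉ with interval z z∈ z∉
    ... | inj₁ all = does-⇔ (mk⇔ (λ _ → adj-sym G (proj₂ (proj₂ (all y y∈))))
                                 (λ _ → adj-sym G (proj₂ (proj₂ (all x x∈))))) (adj? G x z) (adj? G y z)
    ... | inj₂ none = does-⇔ (mk⇔ (λ e → contradiction (z∈ , I⊆X x∈ , adj-sym G e) (none x x∈))
                                  (λ e → contradiction (z∈ , I⊆X y∈ , adj-sym G e) (none y y∈))) (adj? G x z) (adj? G y z)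
    split : Split (true ∷ X) A
    split {suc x} {suc y} _ _ c∈ d∈ x∈ y∈ ¬c ¬d = rows-agree⁺ (agree x∈ y∈ c∈ ¬c) (agree x∈ y∈ d∈ ¬d)

  -- Three vertices and ∞ make four elements, and by `D-cyclic` one of their three pairings is a
  -- split.
  prime⇒4≤ : ∀ {X a b} → Prime (true ∷ X) → a ∈ X → b ∈ X → a ≢ b → 3 ≤ ∣ X ∣ → 4 ≤ ∣ X ∣
  prime⇒4≤ {X} {a} {b} pr a∈ b∈ a≢b 3≤ = conclude
    where
    b∉ : b ∉ ⁅ a ⁆
    b∉ = a≢b ∘ sym ∘ x∈⁅y⁆⇒x≡y a

    ∣ab∣ : ∣ ⁅ a ⁆ ⊕ b ∣ ≡ 2
    ∣ab∣ = trans (∣⊕∣ b∉) (cong suc (∣⁅x⁆∣≡1 a))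

    third : ∃ λ c → c ∈ X × c ∉ ⁅ a ⁆ ⊕ b
    third = fresh (subst (_< ∣ X ∣) (sym ∣ab∣) 3≤)

    conclude : 4 ≤ ∣ X ∣
    conclude with third
    ... | c , c∈ , c∉ with any? (λ d → d ∈? X ×-dec ¬? (d ∈? (⁅ a ⁆ ⊕ b ⊕ c)))
    ...   | yes (d , d∈ , d∉) = subst (_≤ ∣ X ∣) (trans (∣⊕∣ d∉) (cong suc (trans (∣⊕∣ c∉) (cong suc ∣ab∣))))
      (p⊆q⇒∣p∣≤∣q∣ ⊆X)
      where
      ⊆X : ⁅ a ⁆ ⊕ b ⊕ c ⊕ d ⊆ X
      ⊆X x∈ with ⊕⁻ x∈
      ... | inj₂ refl = d∈
      ... | inj₁ x∈ with ⊕⊕⁻ x∈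
      ...   | inj₁ p           = subst (_∈ X) (sym (x∈⁅y⁆⇒x≡y a p)) a∈
      ...   | inj₂ (inj₁ refl) = b∈
      ...   | inj₂ (inj₂ refl) = c∈
    ...   | no none = contradiction pr ¬pr
      where
      a≢c : a ≢ c
      a≢c refl = c∉ (⊕⁺ (x∈⁅x⁆ a))
      b≢c : b ≢ c
      b≢c refl = c∉ ⊕-new
      only : ∀ {x} → x ∈ true ∷ X → x ≡ zero ⊎ x ≡ suc a ⊎ x ≡ suc b ⊎ x ≡ suc c
      only {zero} _ = inj₁ refl
      only {suc x} (there x∈) with ⊕⊕⁻ (decidable-stable (x ∈? (⁅ a ⁆ ⊕ b ⊕ c)) λ x∉ → none (x , x∈ , x∉))
      ... | inj₁ p           = inj₂ (inj₁ (cong suc (x∈⁅y⁆⇒x≡y a p)))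
      ... | inj₂ (inj₁ refl) = inj₂ (inj₂ (inj₁ refl))
      ... | inj₂ (inj₂ refl) = inj₂ (inj₂ (inj₂ refl))
      pairing : ∀ {x y z} → x ∈ X → y ∈ X → z ∈ X → x ≢ y → x ≢ z → y ≢ z →
        (∀ {w} → w ∈ true ∷ X → w ≡ suc x ⊎ w ≡ suc y ⊎ w ≡ suc z ⊎ w ≡ zero) →
        D (suc x) (suc y) (suc z) zero ≡ false → ¬ Prime (true ∷ X)
      pairing x∈ y∈ z∈ x≢y x≢z y≢z = two-two⇒¬prime (there x∈) (there y∈) (there z∈) here
        (x≢y ∘ suc-injective) (λ ()) (≢-sym x≢z ∘ suc-injective) (≢-sym y≢z ∘ suc-injective) (λ ()) (λ ())
      one-false : ∀ r s t → r xor s xor t ≡ false → r ≡ false ⊎ s ≡ false ⊎ t ≡ false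
      one-false false _     _     _ = inj₁ refl
      one-false true  false _     _ = inj₂ (inj₁ refl)
      one-false true  true  false _ = inj₂ (inj₂ refl)
      ¬pr : ¬ Prime (true ∷ X)
      ¬pr with one-false _ _ _ (D-cyclic (suc a) (suc b) (suc c) zero)
      ... | inj₁ p = pairing a∈ b∈ c∈ a≢b a≢c b≢c (λ w∈ → case only w∈ of λ where
        (inj₁ q) → inj₂ (inj₂ (inj₂ q)) ; (inj₂ (inj₁ q)) → inj₁ q
        (inj₂ (inj₂ (inj₁ q))) → inj₂ (inj₁ q) ; (inj₂ (inj₂ (inj₂ q))) → inj₂ (inj₂ (inj₁ q))) p
      ... | inj₂ (inj₁ p) = pairing b∈ c∈ a∈ b≢c (≢-sym a≢b) (≢-sym a≢c) (λ w∈ → case only w∈ of λ where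
        (inj₁ q) → inj₂ (inj₂ (inj₂ q)) ; (inj₂ (inj₁ q)) → inj₂ (inj₂ (inj₁ q))
        (inj₂ (inj₂ (inj₁ q))) → inj₁ q ; (inj₂ (inj₂ (inj₂ q))) → inj₂ (inj₁ q)) p
      ... | inj₂ (inj₂ p) = pairing c∈ a∈ b∈ (≢-sym a≢c) (≢-sym b≢c) a≢b (λ w∈ → case only w∈ of λ where
        (inj₁ q) → inj₂ (inj₂ (inj₂ q)) ; (inj₂ (inj₁ q)) → inj₂ (inj₁ q)
        (inj₂ (inj₂ (inj₁ q))) → inj₂ (inj₂ (inj₁ q)) ; (inj₂ (inj₂ (inj₂ q))) → inj₁ q) p

  4≤⇒big : ∀ {S} → 4 ≤ ∣ S ∣ → Big S
  4≤⇒big {S} 4≤ u v with fresh {S = ⁅ u ⁆ ⊕ v} {S} (≤-trans (s≤s ∣uv∣) (≤-trans (m≤n⇒m≤1+n ≤-refl) 4≤))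
    where
    ∣uv∣ : ∣ ⁅ u ⁆ ⊕ v ∣ ≤ 2
    ∣uv∣ = ≤-trans (∣⊕∣≤ ⁅ u ⁆ v) (s≤s (≤-reflexive (∣⁅x⁆∣≡1 u)))
  ... | c , c∈ , c∉ with fresh {S = ⁅ u ⁆ ⊕ v ⊕ c} {S}
          (≤-trans (s≤s (≤-trans (∣⊕∣≤ (⁅ u ⁆ ⊕ v) c) (s≤s (≤-trans (∣⊕∣≤ ⁅ u ⁆ v) (s≤s (≤-reflexive (∣⁅x⁆∣≡1 u))))))) 4≤)
  ... | d , d∈ , d∉ = c , d , c∈ , d∈ , (λ { refl → d∉ ⊕-new })
      , ((λ { refl → c∉ (⊕⁺ (x∈⁅x⁆ u)) }) , (λ { refl → c∉ ⊕-new }))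
      , ((λ { refl → d∉ (⊕⁺ (⊕⁺ (x∈⁅x⁆ u))) }) , (λ { refl → d∉ (⊕⁺ ⊕-new) }))

  -- Inclusion-minimal indecomposable sets through two vertices.

  Spanning : Fin n → Fin n → Subset n → Set
  Spanning a b X = X ⊆ V G × a ∈ X × b ∈ X × 3 ≤ ∣ X ∣ × Indecomposable (G [ X ])

  spanning? : ∀ a b → Decidable (Spanning a b)
  spanning? a b X = X ⊆? V G ×-dec a ∈? X ×-dec b ∈? X ×-dec 3 ≤? ∣ X ∣ ×-dec indecomposable? (G [ X ])

  minimal-spanning : ∀ {a b} k X → ∣ X ∣ ≤ k → Spanning a b X →
    ∃ λ Y → Spanning a b Y × (∀ Z → Z ⊂ Y → ¬ Spanning a b Z)
  minimal-spanning {a} {b} k X bound sX with anySubset? (λ Z → Z ⊂? X ×-dec spanning? a b Z)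
  ... | no none = X , sX , λ Z Z⊂X sZ → none (Z , Z⊂X , sZ)
  minimal-spanning zero    X bound sX | yes (Z , Z⊂X , sZ) =
    contradiction (≤-trans (p⊂q⇒∣p∣<∣q∣ Z⊂X) bound) λ ()
  minimal-spanning (suc k) X bound sX | yes (Z , Z⊂X , sZ) =
    minimal-spanning k Z (s≤s⁻¹ (≤-trans (p⊂q⇒∣p∣<∣q∣ Z⊂X) bound)) sZ

  induced-whole : Indecomposable G → Indecomposable (G [ V G ])
  induced-whole ind I (I⊆V , interval) = ind I (I⊆V , λ x x∈ x∉ → case interval x x∈ x∉ of λ where
    (inj₁ all)  → inj₁ λ y y∈ → proj₂ (proj₂ (all y y∈))
    (inj₂ none) → inj₂ λ y y∈ e → none y y∈ (x∈ , I⊆V y∈ , e))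

  induced-twice : ∀ {X Y} → X ⊆ Y → Indecomposable ((G [ Y ]) [ X ]) → Indecomposable (G [ X ])
  induced-twice X⊆Y ind I (I⊆X , interval) = ind I (I⊆X , λ x x∈ x∉ → case interval x x∈ x∉ of λ where
    (inj₁ all)  → inj₁ λ y y∈ → let (p , q , e) = all y y∈ in p , q , X⊆Y p , X⊆Y q , e
    (inj₂ none) → inj₂ λ y y∈ (p , q , _ , _ , e) → none y y∈ (p , q , e))

-- From the covering hypothesis to the four cardinalities.

proposition1p6 : ∀ {n : ℕ} (G : Graph n) → Indecomposable G → 6 ≤ v G →
    ∀ (a b : Fin n) → a ∈ V G → b ∈ V G → a ≢ b →
    Covered (𝕀 G) (⁅ a ⁆ ∪ ⁅ b ⁆) →
    ∃ λ (X : Subset n) → X ⊆ V G × a ∈ X × b ∈ X ×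
    (∣ X ∣ ≡ v G ⊎ ∣ X ∣ ≡ v G ∸ 1 ⊎ ∣ X ∣ ≡ v G ∸ 3 ⊎ ∣ X ∣ ≡ v G ∸ 5) ×
    Minimal (G [ X ]) a b
proposition1p6 {n} G ind 6≤ a b a∈ b∈ a≢b (_ , covered)
  with minimal-spanning G ∣ V G ∣ (V G) ≤-refl (id , a∈ , b∈ , ≤-trans (s≤s (s≤s (s≤s z≤n))) 6≤ , induced-whole G ind)
... | X , (X⊆V , a∈X , b∈X , 3≤ , indX) , min = X , X⊆V , a∈X , b∈X , size , record
  { x∈V = a∈X ; y∈V = b∈X ; x≢y = a≢b ; indecomposable = indX ; 4≤v = 4≤X
  ; minimal = λ Z Z⊂X a∈Z b∈Z 3≤Z indZ →
      min Z Z⊂X (X⊆V ∘ proj₁ Z⊂X , a∈Z , b∈Z , 3≤Z , induced-twice G (proj₁ Z⊂X) indZ)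
  }
  where
  open Splits (adjacency G) (adjacency-sym G)

  4≤X : 4 ≤ ∣ X ∣
  4≤X = prime⇒4≤ G (indecomposable⇒prime G indX) a∈X b∈X a≢b 3≤

  T : Subset (suc n)
  T = true ∷ V G

  primeT : Prime T
  primeT = indecomposable⇒prime G (induced-whole G ind)

  room-for-two : ∀ {S : Subset n} → ∣ T ∣ ≡ 2 + ∣ true ∷ S ∣ → 2 + ∣ S ∣ ≤ v G
  room-for-two card = ≤-reflexive (sym (cong (_∸ 1) card))

  -- The two missing vertices form an edge of `𝕀 G`, yet neither is `a` or `b`, which lie in `X` and
  -- hence in `S`.
  codim≢2 : ∀ {S} → true ∷ X ⊆ S → S ⊆ T → Prime S → ∣ T ∣ ≢ 2 + ∣ S ∣
  codim≢2 {false ∷ S} X⊆S _ _ _ with () ← X⊆S here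
  codim≢2 {true ∷ S} X⊆S S⊆T pr card with fresh {S = S} {V G} (≤-trans (m≤n⇒m≤1+n ≤-refl) (room-for-two {S} card))
  ... | x , x∈ , x∉ with fresh {S = S ⊕ x} {V G} (subst (λ c → suc c ≤ v G) (sym (∣⊕∣ x∉)) (room-for-two {S} card))
  ... | y , y∈ , y∉ = hits (covered x y (x∈ , y∈ , x≢y′ , subst (λ R → Indecomposable (G [ R ])) S≡ (prime⇒indecomposable G pr)))
    where
    x≢y′ : x ≢ y
    x≢y′ refl = y∉ ⊕-new
    ⊆V : ∀ {z} → z ∈ V G → S ⊕ x ⊕ y ⊕ z ⊆ V G
    ⊆V z∈ w∈ with ⊕⁻ w∈
    ... | inj₂ refl = z∈
    ... | inj₁ w∈ with ⊕⊕⁻ w∈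
    ...   | inj₁ w∈S         = drop-there (S⊆T (there w∈S))
    ...   | inj₂ (inj₁ refl) = x∈
    ...   | inj₂ (inj₂ refl) = y∈
    z∉⊕⊕ : ∀ {z} → z ∈ V G ─ (⁅ x ⁆ ∪ ⁅ y ⁆) → z ∉ S → z ∉ S ⊕ x ⊕ y
    z∉⊕⊕ z∈ z∉ z∈′ with ⊕⊕⁻ z∈′
    ... | inj₁ z∈S         = z∉ z∈S
    ... | inj₂ (inj₁ refl) = x∈p─q⇒x∉q (V G) _ z∈ (x∈p∪q⁺ (inj₁ (x∈⁅x⁆ x)))
    ... | inj₂ (inj₂ refl) = x∈p─q⇒x∉q (V G) _ z∈ (x∈p∪q⁺ (inj₂ (x∈⁅x⁆ y)))
    S≡ : S ≡ V G ─ (⁅ x ⁆ ∪ ⁅ y ⁆)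
    S≡ = ⊆-antisym
      (λ z∈ → x∈p∧x∉q⇒x∈p─q (drop-there (S⊆T (there z∈)))
        λ z∈xy → case ⊕⁻ {S = ⁅ x ⁆} z∈xy of λ where
          (inj₁ p)    → x∉ (subst (_∈ S) (x∈⁅y⁆⇒x≡y x p) z∈)
          (inj₂ refl) → y∉ (⊕⁺ z∈))
      -- A third vertex outside `S` would exceed the cardinality of `V G`.
      λ {z} z∈ → decidable-stable (z ∈? S) λ z∉ → <-irrefl (sym (cong (_∸ 1) card))
        (subst (_≤ v G) (trans (∣⊕∣ {S = S ⊕ x ⊕ y} (z∉⊕⊕ z∈ z∉)) (cong suc (∣⊕⊕∣ x∉ (y∉ ∘ ⊕⁺) x≢y′)))
          (p⊆q⇒∣p∣≤∣q∣ (⊆V (p─q⊆p (V G) _ z∈))))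
    outside-X : ∀ {z} → z ∉ S → ¬ z ∈ ⁅ a ⁆ ∪ ⁅ b ⁆
    outside-X z∉ z∈ with ⊕⁻ {S = ⁅ a ⁆} z∈
    ... | inj₁ p    = z∉ (drop-there (X⊆S (there (subst (_∈ X) (sym (x∈⁅y⁆⇒x≡y a p)) a∈X))))
    ... | inj₂ refl = z∉ (drop-there (X⊆S (there b∈X)))
    hits : ¬ (x ∈ ⁅ a ⁆ ∪ ⁅ b ⁆ ⊎ y ∈ ⁅ a ⁆ ∪ ⁅ b ⁆)
    hits = [ outside-X x∉ , outside-X (y∉ ∘ ⊕⁺) ]′

  X⊆T : true ∷ X ⊆ T
  X⊆T here       = here
  X⊆T (there x∈) = there (X⊆V x∈)

  open Codimension T primeT (true ∷ X) (4≤⇒big G (m≤n⇒m≤1+n 4≤X)) codim≢2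

  size : ∣ X ∣ ≡ v G ⊎ ∣ X ∣ ≡ v G ∸ 1 ⊎ ∣ X ∣ ≡ v G ∸ 3 ⊎ ∣ X ∣ ≡ v G ∸ 5
  size = by-parity _ (halve _) (sym (m∸n+n≡m (p⊆q⇒∣p∣≤∣q∣ X⊆V)))
    where
    primeX : Prime (true ∷ X)
    primeX = indecomposable⇒prime G indX
    by-parity : ∀ k → (∃ λ j → k ≡ dbl j ⊎ k ≡ suc (dbl j)) → v G ≡ k + ∣ X ∣ →
      ∣ X ∣ ≡ v G ⊎ ∣ X ∣ ≡ v G ∸ 1 ⊎ ∣ X ∣ ≡ v G ∸ 3 ⊎ ∣ X ∣ ≡ v G ∸ 5
    by-parity _ (0     , inj₁ refl) eq = inj₁ (sym eq)
    -- Both `T` and `true ∷ X` count ∞, so the codimension is that of `X` in `V G`.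
    by-parity _ (suc j , inj₁ refl) eq =
      contradiction (trans (cong suc eq) (sym (+-suc (dbl (suc j)) ∣ X ∣))) (even-codim j id X⊆T primeX)
    by-parity _ (0 , inj₂ refl) eq = inj₂ (inj₁ (sym (cong (_∸ 1) eq)))
    by-parity _ (1 , inj₂ refl) eq = inj₂ (inj₂ (inj₁ (sym (cong (_∸ 3) eq))))
    by-parity _ (2 , inj₂ refl) eq = inj₂ (inj₂ (inj₂ (sym (cong (_∸ 5) eq))))
    by-parity _ (suc (suc (suc j)) , inj₂ refl) eq = contradiction
      (mkLevel id X⊆T primeX (trans (cong suc eq) (sym (+-suc (suc (dbl (3 + j))) ∣ X ∣)))) (codim≱7 j)
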